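{- Let $(\mathsf{L}, \models)$ be a self-complementary logic on graphs for which there exists a class $\mathcal{F}$ of simple graphs such that any two simple graphs $G$ and $H$ are homomorphism indistinguishable over $\mathcal{F}$ if and only if they are $\mathsf{L}$-equivalent. Then there exists a minor-closed class $\mathcal{F}'$ of simple graphs such that any two simple graphs $G$ and $H$ are homomorphism indistinguishable over $\mathcal{F}'$ if and only if they are $\mathsf{L}$-equivalent.
   Context: All graphs are finite, undirected, without multiple edges; a simple graph is one without loops. A homomorphism $F \to G$ is a map $h\colon V(F)\to V(G)$ with $h(u)h(v)\in E(G)$ whenever $uv \in E(F)$, and looped vertices mapped to looped vertices; $\hom(F,G)$ is the number of homomorphisms. For a graph class $\mathcal{F}$, $G$ and $H$ are homomorphism indistinguishable over $\mathcal{F}$ (written $G \equiv_{\mathcal{F}} H$) if $\hom(F,G)=\hom(F,H)$ for all $F\in\mathcal{F}$. A logic on graphs is a pair $(\mathsf{L},\models)$ of a class $\mathsf{L}$ of sentences and a relation $\models$ between graphs and sentences that is isomorphism-invariant ($G\cong H$ implies $G\models\phi \iff H\models\phi$ for all $\phi\in\mathsf{L}$). Graphs $G,H$ are $\mathsf{L}$-equivalent if $G\models\phi \iff H\models \phi$ for all $\phi\in\mathsf{L}$. The logic is self-complementary if for every $\phi\in\mathsf{L}$ there is $\overline{\phi}\in\mathsf{L}$ such that for all simple graphs $G$, $G\models\phi$ iff $\overline{G}\models\overline{\phi}$, where $\overline{G}$ is the complement graph (same vertex set, edges exactly the non-edges between distinct vertices). A minor of a simple graph $F$ is a subgraph of a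 graph obtained from $F$ by contracting edges; a class is minor-closed if it contains all minors of its members. -}

module Defs where

open import Data.Bool.Base using (Bool; not; _∧_; T)
open import Data.Bool.Properties using (T?)
open import Data.Fin.Base using (Fin; finToFun)
open import Data.Fin.Properties using (_≟_; all?)
open import Data.List.Base using (allFin; filter; length)
open import Data.Nat.Base using (ℕ; _^_)
open import Data.Product.Base using (∃-syntax; _×_)
open import Data.Sum.Base using (_⊎_)
open import Function.Bundles using (_↔_; _⇔_; Inverse)
open import Function.Definitions using (Injective; StrictlySurjective)
open import Level using (Level; _⊔_; suc)
open import Relation.Binary.Construct.Closure.ReflexiveTransitive using (Star)
open import Relation.Binary.PropositionalEquality
  using (_≡_; _≢_; refl; sym; cong₂)
open import Relation.Nullary using (¬_; yes; no; contradiction)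
open import Relation.Nullary.Decidable using (Dec; isYes; _→-dec_)
open import Relation.Unary using (Pred; _∈_)

private
  variable
    a b f : Level

-- Loops are allowed: u is looped when adj u u holds.
record Graph : Set where
  field
    order   : ℕ
    adj     : Fin order → Fin order → Bool
    adj-sym : ∀ u v → adj u v ≡ adj v u

open Graph public using (order)

V : Graph → Set
V G = Fin (order G)

E : (G : Graph) → V G → V G → Set
E G u v = T (Graph.adj G u v)

Simple : Graph → Set
Simple G = ∀ u → ¬ E G u u

record _≅_ (G H : Graph) : Set where
  field
    bijection : V G ↔ V H
  open Inverse bijection public using (to; from)
  field
    preserves : ∀ u v → E G u v ⇔ E H (to u) (to v)

private
  ≟-sym : ∀ {n} (u v : Fin n) → isYes (u ≟ v) ≡ isYes (v ≟ u)
  ≟-sym u v with u ≟ v | v ≟ u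
  ... | yes _   | yes _   = refl
  ... | no _    | no _    = refl
  ... | yes u≡v | no v≢u  = contradiction (sym u≡v) v≢u
  ... | no u≢v  | yes v≡u = contradiction (sym v≡u) u≢v

complement : Graph → Graph
complement G = record
  { order   = order G
  ; adj     = λ u v → not (isYes (u ≟ v)) ∧ not (adj u v)
  ; adj-sym = λ u v →
      cong₂ (λ p q → not p ∧ not q) (≟-sym u v) (adj-sym u v)
  }
  where open Graph G using (adj; adj-sym)

-- The case u = v says that looped vertices are mapped to looped vertices.
IsHom : (F G : Graph) → (V F → V G) → Set
IsHom F G h = ∀ u v → E F u v → E G (h u) (h v)

isHom? : (F G : Graph) (h : V F → V G) → Dec (IsHom F G h)
isHom? F G h = all? λ u → all? λ v →
  T? (Graph.adj F u v) →-dec T? (Graph.adj G (h u) (h v))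

-- finToFun enumerates every map V F → V G exactly once, up to
-- pointwise equality.
hom : Graph → Graph → ℕ
hom F G = length (filter (λ i → isHom? F G (finToFun i))
                         (allFin (order G ^ order F)))

GraphClass : (f : Level) → Set (suc f)
GraphClass f = Pred Graph f

HomIndistinguishable : GraphClass f → Graph → Graph → Set f
HomIndistinguishable 𝓕 G H = ∀ F → F ∈ 𝓕 → hom F G ≡ hom F H

record Logic (a b : Level) : Set (suc (a ⊔ b)) where
  field
    Sentence  : Set a
    _⊨_       : Graph → Sentence → Set b
    invariant : ∀ {G H} → G ≅ H → ∀ φ → G ⊨ φ ⇔ H ⊨ φ

Equivalent : Logic a b → Graph → Graph → Set (a ⊔ b)
Equivalent 𝓛 G H = ∀ φ → G ⊨ φ ⇔ H ⊨ φ
  where open Logic 𝓛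

SelfComplementary : Logic a b → Set (a ⊔ b)
SelfComplementary 𝓛 =
  ∀ φ → ∃[ φ̄ ] (∀ G → Simple G → G ⊨ φ ⇔ complement G ⊨ φ̄)
  where open Logic 𝓛

-- F′ is, up to isomorphism, the graph obtained from F by contracting one
-- edge uv: the map proj identifies u with v and nothing else. Loops that
-- would arise are discarded, so contractions of simple graphs are simple.
record Contracts (F F′ : Graph) : Set where
  field
    u v        : V F
    edge       : E F u v
    proj       : V F → V F′
    surjective : StrictlySurjective _≡_ proj
    identifies : ∀ x y →
      proj x ≡ proj y ⇔ (x ≡ y ⊎ (x ≡ u × y ≡ v) ⊎ (x ≡ v × y ≡ u))
    edges      : ∀ p q →
      E F′ p q ⇔ (p ≢ q × ∃[ x ] ∃[ y ] (proj x ≡ p × proj y ≡ q × E F x y))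

-- Up to isomorphism, being a subgraph means having an injective homomorphism.
Subgraph : Graph → Graph → Set
Subgraph M K = ∃[ h ] (Injective _≡_ _≡_ h × IsHom M K h)

Minor : Graph → Graph → Set
Minor M F = ∃[ K ] (Star Contracts F K × Subgraph M K)

MinorClosed : GraphClass f → Set f
MinorClosed 𝓕 = ∀ {M F} → F ∈ 𝓕 → Minor M F → M ∈ 𝓕

{-
Let 𝓕′ consist of the simple F for which hom(F, -) cannot tell apart simple graphs that are homomorphism
indistinguishable over 𝓕. Indistinguishability over 𝓕 is preserved by complements, by self-complementarity, and by
categorical products with an arbitrary, possibly looped graph K, because hom(F, -) is multiplicative. Hence, for F in
𝓕′, hom(F, complement (X ⊗ K)) takes the same value at indistinguishable X = G and X = H, for every K.

A map V F → V (X ⊗ K) is a colouring k of F by the vertices of K together with a map g : V F → V X. It is a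
homomorphism to the complement when no edge of F is collapsed by k and g simultaneously and no edge uv of F with
k u ~ k v in K is mapped to an edge by g. Varying K over all graphs on a subset of a fixed set of m colours,
inclusion–exclusion isolates the pairs (k , g) for which k is surjective and every pair of colours in a prescribed
set T is covered by an edge of F that g preserves.

For m = |F| the surjective colourings are bijective, and what remains is a positive multiple of the number of maps
V F → V X preserving a prescribed set of edges of F: this gives closure under subgraphs. For m = |F| - 1 the
pairs (k , g) collapsing an edge are those where k contracts an edge and g factors through k. With T = E F′ they
contribute a positive multiple of hom(F′, X) for a contraction F′ of F, and the count without the restriction on
collapsed edges is already controlled by the first case.
-}
module Submission where

open import Data.Bool.Base using (true; false; if_then_else_; T; not; _∧_)
open import Data.Bool.Properties using (T?; T-∧; ∨-comm)
open import Data.Fin.Base using (Fin; zero; suc; _↑ˡ_; _↑ʳ_; combine; finToFun; punchIn; punchOut; quotient; remainder)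
open import Data.Fin.Properties using (_≟_; remQuot-combine; suc-injective; any?; all?; injective⇒≤; punchIn-punchOut; punchIn-injective; punchInᵢ≢i; punchOut-injective; combine-injective; ¬Fin0)
open import Data.List.Base as List using (List; []; _∷_; _++_; map; length; filter; allFin; cartesianProductWith; cartesianProduct)
open import Data.List.Membership.DecPropositional using (_∈?_)
open import Data.List.Membership.Propositional using () renaming (_∈_ to _∈ₗ_)
open import Data.List.Membership.Propositional.Properties using (∈-lookup; ∈-allFin; ∈-filter⁺; ∈-cartesianProduct⁺; ∈-filter⁻; ∈-map⁺; ∈-map⁻)
open import Data.List.Properties using (map-cong; map-∘; map-++; map-tabulate; tabulate-lookup; length-tabulate)
open import Data.List.Relation.Unary.All as All using (All; []; _∷_)
open import Data.List.Relation.Unary.AllPairs using (_∷_)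
open import Data.List.Relation.Unary.Unique.Propositional using (Unique)
open import Data.List.Relation.Unary.Unique.Propositional.Properties using (allFin⁺; filter⁺)
open import Data.Nat.Base using (ℕ; zero; suc; _+_; _*_; _^_; _∸_; _≤_; z≤n; NonZero; >-nonZero; ≢-nonZero)
open import Data.Nat.ListAction using (sum; product)
open import Data.Nat.ListAction.Properties using (sum-++)
open import Data.Nat.Properties hiding (_≟_; suc-injective)
open import Data.Nat.Properties using () renaming (_≟_ to _≟ℕ_)
open import Data.Product.Base using (Σ-syntax; ∃-syntax; _×_; _,_; proj₁; proj₂; uncurry)
open import Data.Product.Properties using () renaming (≡-dec to ×-≡-dec)
open import Data.Sum.Base using (_⊎_; inj₁; inj₂; [_,_]′)
open import Data.Vec.Base as Vec using (Vec; []; _∷_; lookup; zipWith; insertAt; tabulate)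
open import Data.Vec.Properties using (≡-dec; ∷-injective; insertAt-lookup; insertAt-punchIn; lookup∘tabulate; tabulate∘lookup; tabulate-cong; lookup-zipWith; lookup-map)
import Data.Vec.Relation.Unary.All as VAll
open import Data.Vec.Relation.Unary.All.Properties using (lookup⁺; lookup⁻)
open import Defs
open import Function.Base using (_∘_; id; case_of_)
open import Function.Bundles using (_⇔_; mk⇔; Equivalence)
open import Function.Construct.Identity using (↔-id)
open import Function.Definitions using (Injective; StrictlySurjective)
open import Function.Properties.Equivalence using () renaming (sym to ⇔-sym; trans to ⇔-trans)
open import Level using (Level)
open import Relation.Binary.Construct.Closure.ReflexiveTransitive using (Star; ε; _◅_)
open import Relation.Binary.Definitions using (DecidableEquality; tri<; tri≈; tri>)
open import Relation.Binary.PropositionalEquality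
open import Relation.Nullary using (Dec; yes; no; does; ¬_; contradiction)
open import Relation.Nullary.Decidable using (_×-dec_; ¬?; does-⇔; _→-dec_; isYes; decidable-stable; _⊎-dec_)
open import Relation.Unary using (Pred; Decidable; _∈_; _⊆_)

open import Algebra.Properties.CommutativeSemigroup +-commutativeSemigroup using (interchange)
open import Algebra.Properties.CommutativeSemigroup *-commutativeSemigroup using (x∙yz≈y∙xz; xy∙z≈xz∙y)

open Equivalence using (to; from)

private variable
  ℓ : Level
  A B C : Set ℓ
  P Q : Set ℓ
  m n N : ℕ

-- Indicators of decidable propositions and their products.

-- The Iverson bracket. Only the Boolean `does P?` enters, so equivalent propositions have equal
-- brackets however they are decided.
⟦_⟧ : Dec P → ℕ
⟦ P? ⟧ = if does P? then 1 else 0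

⟦⟧-cong : (P? : Dec P) (Q? : Dec Q) → P ⇔ Q → ⟦ P? ⟧ ≡ ⟦ Q? ⟧
⟦⟧-cong P? Q? P⇔Q = cong (if_then 1 else 0) (does-⇔ P⇔Q P? Q?)

⟦⟧-yes : (P? : Dec P) → P → ⟦ P? ⟧ ≡ 1
⟦⟧-yes (yes _) _ = refl
⟦⟧-yes (no ¬p) p = contradiction p ¬p

⟦⟧-× : (P? : Dec P) (Q? : Dec Q) → ⟦ P? ×-dec Q? ⟧ ≡ ⟦ P? ⟧ * ⟦ Q? ⟧
⟦⟧-× (yes _) (yes _) = refl
⟦⟧-× (yes _) (no _)  = refl
⟦⟧-× (no _)  (yes _) = refl
⟦⟧-× (no _)  (no _)  = refl

⟦⟧-¬ : (P? : Dec P) → ⟦ P? ⟧ + ⟦ ¬? P? ⟧ ≡ 1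
⟦⟧-¬ (yes _) = refl
⟦⟧-¬ (no _)  = refl

-- A term weighted by `⟦ P? ⟧` may be rewritten under the assumption `P`. This is how surjectivity
-- of a colouring becomes available inside a sum.
⟦⟧-*-cong : (P? : Dec P) {x y : ℕ} → (P → x ≡ y) → ⟦ P? ⟧ * x ≡ ⟦ P? ⟧ * y
⟦⟧-*-cong (yes p) eq = cong (1 *_) (eq p)
⟦⟧-*-cong (no _)  _  = refl

∏ : List A → (A → ℕ) → ℕ
∏ xs f = product (map f xs)

∏-⟦⟧ : {P : Pred A ℓ} (P? : Decidable P) (xs : List A) →
       ∏ xs (λ x → ⟦ P? x ⟧) ≡ ⟦ All.all? P? xs ⟧
∏-⟦⟧ P? []       = refl
∏-⟦⟧ P? (x ∷ xs) = trans (cong (⟦ P? x ⟧ *_) (∏-⟦⟧ P? xs))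
  (trans (sym (⟦⟧-× (P? x) (All.all? P? xs)))
    (⟦⟧-cong (P? x ×-dec All.all? P? xs) (All.all? P? (x ∷ xs)) (mk⇔ (uncurry _∷_) λ { (p ∷ ps) → p , ps })))

-- Finite sums over lists.

∑ : List A → (A → ℕ) → ℕ
∑ xs f = sum (map f xs)

∑-cong : (xs : List A) {f g : A → ℕ} → (∀ x → f x ≡ g x) → ∑ xs f ≡ ∑ xs g
∑-cong xs f≗g = cong sum (map-cong f≗g xs)

∑-map : (h : A → B) (xs : List A) (f : B → ℕ) → ∑ (map h xs) f ≡ ∑ xs (f ∘ h)
∑-map h xs f = cong sum (sym (map-∘ xs))

∑-++ : (xs ys : List A) (f : A → ℕ) → ∑ (xs ++ ys) f ≡ ∑ xs f + ∑ ys f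
∑-++ xs ys f = trans (cong sum (map-++ f xs ys)) (sum-++ (map f xs) (map f ys))

∑-+ : (xs : List A) (f g : A → ℕ) → ∑ xs (λ x → f x + g x) ≡ ∑ xs f + ∑ xs g
∑-+ []       f g = refl
∑-+ (x ∷ xs) f g = trans (cong (f x + g x +_) (∑-+ xs f g)) (interchange (f x) (g x) (∑ xs f) (∑ xs g))

∑-*ˡ : (c : ℕ) (xs : List A) (f : A → ℕ) → ∑ xs (λ x → c * f x) ≡ c * ∑ xs f
∑-*ˡ c []       f = sym (*-zeroʳ c)
∑-*ˡ c (x ∷ xs) f = trans (cong (c * f x +_) (∑-*ˡ c xs f)) (sym (*-distribˡ-+ c (f x) (∑ xs f)))

∑-*ʳ : (c : ℕ) (xs : List A) (f : A → ℕ) → ∑ xs (λ x → f x * c) ≡ ∑ xs f * c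
∑-*ʳ c xs f = trans (∑-cong xs λ x → *-comm (f x) c) (trans (∑-*ˡ c xs f) (*-comm c (∑ xs f)))

∑-zero : (xs : List A) → ∑ xs (λ _ → 0) ≡ 0
∑-zero []       = refl
∑-zero (x ∷ xs) = ∑-zero xs

∑-swap : (xs : List A) (ys : List B) (f : A → B → ℕ) →
         ∑ xs (λ x → ∑ ys (f x)) ≡ ∑ ys (λ y → ∑ xs (λ x → f x y))
∑-swap []       ys f = sym (∑-zero ys)
∑-swap (x ∷ xs) ys f = trans (cong (∑ ys (f x) +_) (∑-swap xs ys f)) (sym (∑-+ ys (f x) _))

∑-cartesianProductWith : (h : A → B → C) (xs : List A) (ys : List B) (f : C → ℕ) →
  ∑ (cartesianProductWith h xs ys) f ≡ ∑ xs (λ x → ∑ ys (λ y → f (h x y)))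
∑-cartesianProductWith h []       ys f = refl
∑-cartesianProductWith h (x ∷ xs) ys f =
  trans (∑-++ (map (h x) ys) _ f) (cong₂ _+_ (∑-map (h x) ys f) (∑-cartesianProductWith h xs ys f))

∑-filter : {P : Pred A ℓ} (P? : Decidable P) (xs : List A) (f : A → ℕ) →
           ∑ (filter P? xs) f ≡ ∑ xs (λ x → ⟦ P? x ⟧ * f x)
∑-filter P? []       f = refl
∑-filter P? (x ∷ xs) f with does (P? x)
... | true  = cong₂ _+_ (sym (*-identityˡ (f x))) (∑-filter P? xs f)
... | false = ∑-filter P? xs f

length-filter : {P : Pred A ℓ} (P? : Decidable P) (xs : List A) →
                length (filter P? xs) ≡ ∑ xs (λ x → ⟦ P? x ⟧)
length-filter P? []       = refl
length-filter P? (x ∷ xs) with does (P? x)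
... | true  = cong suc (length-filter P? xs)
... | false = length-filter P? xs

∑-allFin-suc : (f : Fin (suc n) → ℕ) → ∑ (allFin (suc n)) f ≡ f zero + ∑ (allFin n) (f ∘ suc)
∑-allFin-suc {n} f = cong (λ xs → f zero + sum xs)
  (trans (map-tabulate suc f) (sym (map-tabulate id (f ∘ suc))))

∑-allFin-+ : ∀ m n (f : Fin (m + n) → ℕ) →
  ∑ (allFin (m + n)) f ≡ ∑ (allFin m) (λ i → f (i ↑ˡ n)) + ∑ (allFin n) (λ j → f (m ↑ʳ j))
∑-allFin-+ zero    n f = refl
∑-allFin-+ (suc m) n f = begin
  _  ≡⟨ ∑-allFin-suc f ⟩
  _  ≡⟨ cong (f zero +_) (∑-allFin-+ m n (f ∘ suc)) ⟩
  _  ≡⟨ +-assoc (f zero) (∑ (allFin m) (λ i → f (suc i ↑ˡ n))) (∑ (allFin n) (λ j → f (suc m ↑ʳ j))) ⟨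
  _  ≡⟨ cong (_+ ∑ (allFin n) (λ j → f (suc m ↑ʳ j))) (sym (∑-allFin-suc {m} (λ i → f (i ↑ˡ n)))) ⟩
  _  ∎
  where open ≡-Reasoning

∑-allFin-* : ∀ m n (f : Fin (m * n) → ℕ) →
  ∑ (allFin (m * n)) f ≡ ∑ (allFin m) (λ i → ∑ (allFin n) (λ j → f (combine i j)))
∑-allFin-* zero    n f = refl
∑-allFin-* (suc m) n f = begin
  _  ≡⟨ ∑-allFin-+ n (m * n) f ⟩
  _  ≡⟨ cong (∑ (allFin n) (λ j → f (j ↑ˡ (m * n))) +_) (∑-allFin-* m n (λ i → f (n ↑ʳ i))) ⟩
  _  ≡⟨ ∑-allFin-suc {m} (λ i → ∑ (allFin n) (λ j → f (combine i j))) ⟨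
  _  ∎
  where open ≡-Reasoning

∑-δ : (i : Fin n) (f : Fin n → ℕ) → ∑ (allFin n) (λ j → ⟦ j ≟ i ⟧ * f j) ≡ f i
∑-δ {suc n} zero f = begin
  _  ≡⟨ ∑-allFin-suc (λ j → ⟦ j ≟ zero ⟧ * f j) ⟩
  f zero + 0 + ∑ (allFin n) (λ _ → 0)  ≡⟨ cong₂ _+_ (+-identityʳ (f zero)) (∑-zero (allFin n)) ⟩
  f zero + 0  ≡⟨ +-identityʳ (f zero) ⟩
  f zero  ∎
  where open ≡-Reasoning
∑-δ {suc n} (suc i) f = trans (∑-allFin-suc (λ j → ⟦ j ≟ suc i ⟧ * f j))
  (trans (∑-cong (allFin n) λ j → cong (_* f (suc j)) (⟦⟧-cong (suc j ≟ suc i) (j ≟ i)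
    (mk⇔ suc-injective (cong suc)))) (∑-δ i (f ∘ suc)))

-- Sums over maps between finite sets.

-- Vectors stand for maps on `Fin n`: unlike functions, they are equal as soon as they agree
-- pointwise, and equality over `Fin m` is decidable.
vecs : List A → ∀ n → List (Vec A n)
vecs xs zero    = [] ∷ []
vecs xs (suc n) = cartesianProductWith _∷_ xs (vecs xs n)

∑-vecs-suc : (xs : List A) (f : Vec A (suc n) → ℕ) →
  ∑ (vecs xs (suc n)) f ≡ ∑ xs (λ x → ∑ (vecs xs n) (λ v → f (x ∷ v)))
∑-vecs-suc xs f = ∑-cartesianProductWith _∷_ xs (vecs xs _) f

∑-vecs-map : (h : A → B) (xs : List A) (f : Vec B n → ℕ) →
  ∑ (vecs (map h xs) n) f ≡ ∑ (vecs xs n) (f ∘ Vec.map h)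
∑-vecs-map {n = zero}  h xs f = refl
∑-vecs-map {n = suc n} h xs f = begin
  _  ≡⟨ ∑-vecs-suc (map h xs) f ⟩
  _  ≡⟨ ∑-map h xs _ ⟩
  _  ≡⟨ ∑-cong xs (λ x → ∑-vecs-map h xs (λ v → f (h x ∷ v))) ⟩
  _  ≡⟨ ∑-vecs-suc xs (f ∘ Vec.map h) ⟨
  _  ∎
  where open ≡-Reasoning

∑-vecs-filter : {P : Pred A ℓ} (P? : Decidable P) (xs : List A) (f : Vec A n → ℕ) →
  ∑ (vecs (filter P? xs) n) f ≡ ∑ (vecs xs n) (λ v → ⟦ VAll.all? P? v ⟧ * f v)
∑-vecs-filter {n = zero}  P? xs f = cong (_+ 0) (sym (*-identityˡ (f [])))
∑-vecs-filter {n = suc n} P? xs f = begin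
  _  ≡⟨ ∑-vecs-suc (filter P? xs) f ⟩
  _  ≡⟨ ∑-filter P? xs _ ⟩
  _  ≡⟨ ∑-cong xs (λ x → cong (⟦ P? x ⟧ *_) (∑-vecs-filter P? xs (λ v → f (x ∷ v)))) ⟩
  _  ≡⟨ ∑-cong xs (λ x → sym (∑-*ˡ ⟦ P? x ⟧ (vecs xs n) _)) ⟩
  _  ≡⟨ ∑-cong xs (λ x → ∑-cong (vecs xs n) (λ v → step x v)) ⟩
  _  ≡⟨ ∑-vecs-suc xs _ ⟨
  _  ∎
  where
  open ≡-Reasoning
  step : ∀ x v → ⟦ P? x ⟧ * (⟦ VAll.all? P? v ⟧ * f (x ∷ v)) ≡ ⟦ VAll.all? P? (x ∷ v) ⟧ * f (x ∷ v)
  step x v = trans (sym (*-assoc ⟦ P? x ⟧ _ _)) (cong (_* f (x ∷ v))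
    (trans (sym (⟦⟧-× (P? x) (VAll.all? P? v)))
      (⟦⟧-cong (P? x ×-dec VAll.all? P? v) (VAll.all? P? (x ∷ v)) (mk⇔ (uncurry VAll._∷_) VAll.uncons))))

∑-vecs-* : ∀ a b (f : Vec (Fin (a * b)) n → ℕ) →
  ∑ (vecs (allFin (a * b)) n) f ≡
  ∑ (vecs (allFin a) n) (λ v → ∑ (vecs (allFin b) n) (λ w → f (zipWith combine v w)))
∑-vecs-* {n = zero} a b f = cong (_+ 0) (sym (+-identityʳ (f [])))
∑-vecs-* {n = suc n} a b f = begin
  _  ≡⟨ ∑-vecs-suc (allFin (a * b)) f ⟩
  _  ≡⟨ ∑-allFin-* a b _ ⟩
  _  ≡⟨ ∑-cong (allFin a) (λ i → ∑-cong (allFin b) (λ j → ∑-vecs-* a b (λ u → f (combine i j ∷ u)))) ⟩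
  _  ≡⟨ ∑-cong (allFin a) (λ i → ∑-swap (allFin b) (vecs (allFin a) n) _) ⟩
  _  ≡⟨ ∑-cong (allFin a) (λ i → ∑-cong (vecs (allFin a) n) (λ v → sym (∑-vecs-suc (allFin b) _))) ⟩
  _  ≡⟨ ∑-vecs-suc (allFin a) _ ⟨
  _  ∎
  where open ≡-Reasoning

-- Passes from the enumeration that defines `hom` to vectors. The hypothesis on `f` takes the place
-- of function extensionality.
∑-finToFun : ∀ a n (f : (Fin n → Fin a) → ℕ) → (∀ {g h} → g ≗ h → f g ≡ f h) →
  ∑ (allFin (a ^ n)) (f ∘ finToFun) ≡ ∑ (vecs (allFin a) n) (f ∘ lookup)
∑-finToFun a zero    f resp = cong (_+ 0) (resp λ ())
∑-finToFun a (suc n) f resp = begin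
  _  ≡⟨ ∑-allFin-* a (a ^ n) _ ⟩
  _  ≡⟨ ∑-cong (allFin a) (λ i → trans
          (∑-cong (allFin (a ^ n)) (λ j → resp {h = i ∷ᶠ finToFun j} (unfold i j)))
          (∑-finToFun a n (λ g → f (i ∷ᶠ g)) (λ g≗h → resp λ { zero → refl ; (suc x) → g≗h x }))) ⟩
  _  ≡⟨ ∑-cong (allFin a) (λ i → ∑-cong (vecs (allFin a) n) (λ v → resp λ { zero → refl ; (suc x) → refl })) ⟩
  _  ≡⟨ ∑-vecs-suc (allFin a) (f ∘ lookup) ⟨
  _  ∎
  where
  open ≡-Reasoning
  _∷ᶠ_ : ∀ {n} → Fin a → (Fin n → Fin a) → Fin (suc n) → Fin a
  (i ∷ᶠ g) zero    = i
  (i ∷ᶠ g) (suc x) = g x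
  unfold : ∀ i j → finToFun {a} {suc n} (combine i j) ≗ i ∷ᶠ finToFun j
  unfold i j zero    = cong proj₁ (remQuot-combine i j)
  unfold i j (suc x) = cong (λ p → finToFun (proj₂ p) x) (remQuot-combine i j)

_≟ᵥ_ : DecidableEquality (Vec (Fin m) n)
_≟ᵥ_ = ≡-dec _≟_

∑-vecs-δ : (v : Vec (Fin m) n) (f : Vec (Fin m) n → ℕ) →
  ∑ (vecs (allFin m) n) (λ w → ⟦ w ≟ᵥ v ⟧ * f w) ≡ f v
∑-vecs-δ []      f = trans (+-identityʳ _) (+-identityʳ (f []))
∑-vecs-δ {m} {suc n} (i ∷ v) f = begin
  _  ≡⟨ ∑-vecs-suc (allFin m) _ ⟩
  _  ≡⟨ ∑-cong (allFin m) (λ j → ∑-cong (vecs (allFin m) n) (λ w → step j w)) ⟩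
  _  ≡⟨ ∑-cong (allFin m) (λ j → ∑-*ˡ ⟦ j ≟ i ⟧ (vecs (allFin m) n) _) ⟩
  _  ≡⟨ ∑-δ i _ ⟩
  _  ≡⟨ ∑-vecs-δ v (λ w → f (i ∷ w)) ⟩
  _  ∎
  where
  open ≡-Reasoning
  step : ∀ j w → ⟦ (j ∷ w) ≟ᵥ (i ∷ v) ⟧ * f (j ∷ w) ≡ ⟦ j ≟ i ⟧ * (⟦ w ≟ᵥ v ⟧ * f (j ∷ w))
  step j w = trans (cong (_* f (j ∷ w)) (trans
    (⟦⟧-cong ((j ∷ w) ≟ᵥ (i ∷ v)) ((j ≟ i) ×-dec (w ≟ᵥ v)) (mk⇔ ∷-injective (uncurry (cong₂ _∷_))))
    (⟦⟧-× (j ≟ i) (w ≟ᵥ v)))) (*-assoc ⟦ j ≟ i ⟧ _ _)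

-- The coordinates can be summed in any order, so coordinate `i` may come first.
∑-vecs-insertAt : (xs : List A) (i : Fin (suc n)) (f : Vec A (suc n) → ℕ) →
  ∑ (vecs xs (suc n)) f ≡ ∑ xs (λ x → ∑ (vecs xs n) (λ v → f (insertAt v i x)))
∑-vecs-insertAt xs zero f = ∑-vecs-suc xs f
∑-vecs-insertAt {n = suc n} xs (suc i) f = begin
  _  ≡⟨ ∑-vecs-suc xs f ⟩
  _  ≡⟨ ∑-cong xs (λ y → ∑-vecs-insertAt xs i (λ v → f (y ∷ v))) ⟩
  _  ≡⟨ ∑-swap xs xs _ ⟩
  _  ≡⟨ ∑-cong xs (λ x → sym (∑-vecs-suc xs (λ v → f (insertAt v (suc i) x)))) ⟩
  _  ∎
  where open ≡-Reasoning

∑-const : (xs : List A) (c : ℕ) → ∑ xs (λ _ → c) ≡ length xs * c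
∑-const []       c = refl
∑-const (x ∷ xs) c = cong (c +_) (∑-const xs c)

-- Inclusion-exclusion.

-- Since f·∏c̄·cₜ + f·c̄ₜ·∏c̄ = f·∏c̄, each factor c̄ can be traded for c.
module _ {W : Set} {A : W → Set} (xs : ∀ X → List (A X)) {I : Set}
         (c c̄ : I → ∀ {X} → A X → ℕ) (c+c̄≡1 : ∀ i {X} (x : A X) → c i x + c̄ i x ≡ 1)
         (f : ∀ {X} → A X → ℕ) {G H : W} where

  private
    S̄ : List I → List I → W → ℕ
    S̄ S T X = ∑ (xs X) λ x → f x * ∏ S (λ i → c̄ i x) * ∏ T (λ i → c i x)

    split : ∀ S i T X → S̄ S (i ∷ T) X + S̄ (i ∷ S) T X ≡ S̄ S T X
    split S i T X = trans (sym (∑-+ (xs X) _ _)) (∑-cong (xs X) λ x →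
      pointwise (f x) (∏ S λ j → c̄ j x) (∏ T λ j → c j x) (c i x) (c̄ i x) (c+c̄≡1 i x))
      where
      open ≡-Reasoning
      pointwise : ∀ a b d p q → p + q ≡ 1 → a * b * (p * d) + a * (q * b) * d ≡ a * b * d
      pointwise a b d p q p+q≡1 = begin
        a * b * (p * d) + a * (q * b) * d    ≡⟨ cong₂ _+_ (x∙yz≈y∙xz (a * b) p d)
                                                  (trans (cong (_* d) (x∙yz≈y∙xz a q b)) (*-assoc q (a * b) d)) ⟩
        p * (a * b * d) + q * (a * b * d)    ≡⟨ *-distribʳ-+ (a * b * d) p q ⟨
        (p + q) * (a * b * d)                ≡⟨ cong (_* (a * b * d)) p+q≡1 ⟩
        1 * (a * b * d)                      ≡⟨ *-identityˡ _ ⟩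
        a * b * d                            ∎

    go : (∀ S → S̄ S [] G ≡ S̄ S [] H) → ∀ T S → S̄ S T G ≡ S̄ S T H
    go hyp []      S = hyp S
    -- In place of a subtraction, the sum in which `i` has moved to `S` is added on both sides and
    -- cancelled; it is known by induction since `T` is shorter.
    go hyp (i ∷ T) S = +-cancelʳ-≡ (S̄ (i ∷ S) T G) _ _ (begin
      S̄ S (i ∷ T) G + S̄ (i ∷ S) T G  ≡⟨ split S i T G ⟩
      S̄ S T G                        ≡⟨ go hyp T S ⟩
      S̄ S T H                        ≡⟨ split S i T H ⟨
      S̄ S (i ∷ T) H + S̄ (i ∷ S) T H  ≡⟨ cong (S̄ S (i ∷ T) H +_) (go hyp T (i ∷ S)) ⟨
      S̄ S (i ∷ T) H + S̄ (i ∷ S) T G  ∎)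
      where open ≡-Reasoning

  inclusion-exclusion :
    (∀ S → ∑ (xs G) (λ x → f x * ∏ S (λ i → c̄ i x)) ≡ ∑ (xs H) (λ x → f x * ∏ S (λ i → c̄ i x))) →
    ∀ T → ∑ (xs G) (λ x → f x * ∏ T (λ i → c i x)) ≡ ∑ (xs H) (λ x → f x * ∏ T (λ i → c i x))
  inclusion-exclusion hyp T = begin
    _           ≡⟨ ∑-cong (xs G) (λ x → cong (_* ∏ T (λ i → c i x)) (*-identityʳ (f x))) ⟨
    S̄ [] T G    ≡⟨ go (λ S → trans (∑-cong (xs G) λ _ → *-identityʳ _)
                      (trans (hyp S) (sym (∑-cong (xs H) λ _ → *-identityʳ _)))) T [] ⟩
    S̄ [] T H    ≡⟨ ∑-cong (xs H) (λ x → cong (_* ∏ T (λ i → c i x)) (*-identityʳ (f x))) ⟩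
    _           ∎
    where open ≡-Reasoning

-- Factoring maps through surjections and restricting them along injections.

reindex : (Fin m → Fin n) → Vec A n → Vec A m
reindex h g = tabulate (lookup g ∘ h)

lookup-reindex : (h : Fin m → Fin n) (g : Vec A n) (i : Fin m) → lookup (reindex h g) i ≡ lookup g (h i)
lookup-reindex h g = lookup∘tabulate (lookup g ∘ h)

vec-ext : {v w : Vec A n} → (∀ i → lookup v i ≡ lookup w i) → v ≡ w
vec-ext {v = v} {w} eq = trans (sym (tabulate∘lookup v)) (trans (tabulate-cong eq) (tabulate∘lookup w))

Respects : (Fin n → Fin m) → Vec (Fin N) n → Set
Respects k g = ∀ u v → k u ≡ k v → lookup g u ≡ lookup g v

respects? : (k : Fin n → Fin m) (g : Vec (Fin N) n) → Dec (Respects k g)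
respects? k g = all? λ u → all? λ v → (k u ≟ k v) →-dec (lookup g u ≟ lookup g v)

-- The maps constant on the fibres of k are exactly those that factor through k, in a unique way.
∑-respects : (k : Fin n → Fin m) → StrictlySurjective _≡_ k → (f : Vec (Fin N) n → ℕ) →
  ∑ (vecs (allFin N) n) (λ g → ⟦ respects? k g ⟧ * f g) ≡ ∑ (vecs (allFin N) m) (f ∘ reindex k)
∑-respects {n} {m} {N} k surj f = sym (begin
  ∑ ys (f ∘ reindex k)
    -- Double counting: after the delta is inserted and the sums are swapped, the inner sum counts
    -- the `g′` through which `g` factors. The section `s` leaves `reindex s g` as the only
    -- candidate.
    ≡⟨ ∑-cong ys (λ g′ → sym (∑-vecs-δ (reindex k g′) f)) ⟩
  ∑ ys (λ g′ → ∑ xs (λ g → ⟦ g ≟ᵥ reindex k g′ ⟧ * f g))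
    ≡⟨ ∑-swap ys xs _ ⟩
  ∑ xs (λ g → ∑ ys (λ g′ → ⟦ g ≟ᵥ reindex k g′ ⟧ * f g))
    ≡⟨ ∑-cong xs (λ g → ∑-*ʳ (f g) ys _) ⟩
  ∑ xs (λ g → ∑ ys (λ g′ → ⟦ g ≟ᵥ reindex k g′ ⟧) * f g)
    ≡⟨ ∑-cong xs (λ g → cong (_* f g) (unique g)) ⟩
  ∑ xs (λ g → ⟦ respects? k g ⟧ * f g)  ∎)
  where
  open ≡-Reasoning
  xs = vecs (allFin N) n
  ys = vecs (allFin N) m
  s : Fin m → Fin n
  s = proj₁ ∘ surj
  k∘s : ∀ a → k (s a) ≡ a
  k∘s = proj₂ ∘ surj

  factors : ∀ g g′ → g ≡ reindex k g′ ⇔ (g′ ≡ reindex s g × Respects k g)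
  factors g g′ = mk⇔
    (λ { refl → vec-ext (λ a → sym (trans (lookup-reindex s (reindex k g′) a)
                  (trans (lookup-reindex k g′ (s a)) (cong (lookup g′) (k∘s a)))))
              , λ u v ku≡kv → trans (lookup-reindex k g′ u)
                  (trans (cong (lookup g′) ku≡kv) (sym (lookup-reindex k g′ v))) })
    (λ { (refl , resp) → vec-ext λ u → sym (trans (lookup-reindex k (reindex s g) u)
                  (trans (lookup-reindex s g (k u)) (resp _ u (k∘s (k u))))) })

  unique : ∀ g → ∑ ys (λ g′ → ⟦ g ≟ᵥ reindex k g′ ⟧) ≡ ⟦ respects? k g ⟧
  unique g = trans (∑-cong ys λ g′ → trans
      (⟦⟧-cong (g ≟ᵥ reindex k g′) ((g′ ≟ᵥ reindex s g) ×-dec respects? k g) (factors g g′))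
      (⟦⟧-× (g′ ≟ᵥ reindex s g) (respects? k g)))
    (∑-vecs-δ (reindex s g) (λ _ → ⟦ respects? k g ⟧))

-- A map on `m` points extends along `h` by free choices outside its image. The induction on `n`
-- asks whether `zero` is in the image: if not, it contributes a free factor; if `zero` is `h i`,
-- its value is coordinate `i` of the restricted map.
∑-reindex : (h : Fin m → Fin n) → Injective _≡_ _≡_ h → (xs : List A) (f : Vec A m → ℕ) →
  ∑ (vecs xs n) (f ∘ reindex h) ≡ length xs ^ (n ∸ m) * ∑ (vecs xs m) f
∑-reindex {m = zero}  {n = zero}  h inj xs f = sym (+-identityʳ (f [] + 0))
∑-reindex {m = suc m} {n = zero}  h inj xs f with () ← h zero
∑-reindex {m = m}     {n = suc n} h inj xs f with any? (λ i → zero ≟ h i)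
... | no ¬p = begin
  _  ≡⟨ ∑-vecs-suc xs (f ∘ reindex h) ⟩
  _  ≡⟨ ∑-cong xs (λ x → ∑-cong (vecs xs n) (λ v → cong f (tabulate-cong (λ i →
          cong (lookup (x ∷ v)) (sym (punchIn-punchOut (λ eq → ¬p (i , eq)))))))) ⟩
  _  ≡⟨ ∑-cong xs (λ x → ∑-reindex h′ h′-inj xs f) ⟩
  _  ≡⟨ ∑-const xs _ ⟩
  _  ≡⟨ *-assoc (length xs) (length xs ^ (n ∸ m)) _ ⟨
  -- Subtraction is truncated, so the exponent grows by one only because `m ≤ n`, which the
  -- injection `h′` guarantees.
  _  ≡⟨ cong (λ e → length xs ^ e * ∑ (vecs xs m) f) (+-∸-assoc 1 (injective⇒≤ h′-inj)) ⟨
  _  ∎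
  where
  open ≡-Reasoning
  h′ : Fin m → Fin n
  h′ i = punchOut {i = zero} {h i} (λ eq → ¬p (i , eq))
  h′-inj : Injective _≡_ _≡_ h′
  h′-inj eq = inj (punchOut-injective (λ p → ¬p (_ , p)) (λ p → ¬p (_ , p)) eq)
∑-reindex {m = suc m} {n = suc n} h inj xs f | yes (i , 0≡hi) = begin
  _  ≡⟨ ∑-vecs-suc xs (f ∘ reindex h) ⟩
  _  ≡⟨ ∑-cong xs (λ x → ∑-cong (vecs xs n) (λ v → cong f (vec-ext (extend x v)))) ⟩
  _  ≡⟨ ∑-cong xs (λ x → ∑-reindex h′ h′-inj xs (λ w → f (insertAt w i x))) ⟩
  _  ≡⟨ ∑-*ˡ (length xs ^ (n ∸ m)) xs _ ⟩
  _  ≡⟨ cong (length xs ^ (n ∸ m) *_) (∑-vecs-insertAt xs i f) ⟨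
  _  ∎
  where
  open ≡-Reasoning
  0≢h : ∀ j → zero ≢ h (punchIn i j)
  0≢h j eq = punchInᵢ≢i i j (inj (trans (sym eq) 0≡hi))
  h′ : Fin m → Fin n
  h′ j = punchOut (0≢h j)
  h′-inj : Injective _≡_ _≡_ h′
  h′-inj eq = punchIn-injective i _ _ (inj (punchOut-injective (0≢h _) (0≢h _) eq))
  extend : ∀ x v j → lookup (reindex h (x ∷ v)) j ≡ lookup (insertAt (reindex h′ v) i x) j
  extend x v j with i ≟ j
  ... | yes refl = trans (lookup-reindex h (x ∷ v) i)
    (trans (cong (lookup (x ∷ v)) (sym 0≡hi)) (sym (insertAt-lookup (reindex h′ v) i x)))
  ... | no i≢j = begin
    _  ≡⟨ cong (lookup (reindex h (x ∷ v))) (punchIn-punchOut i≢j) ⟨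
    _  ≡⟨ lookup-reindex h (x ∷ v) (punchIn i j′) ⟩
    _  ≡⟨ cong (lookup (x ∷ v)) (punchIn-punchOut (0≢h j′)) ⟨
    _  ≡⟨ lookup-reindex h′ v j′ ⟨
    _  ≡⟨ insertAt-punchIn (reindex h′ v) i x j′ ⟨
    _  ≡⟨ cong (lookup (insertAt (reindex h′ v) i x)) (punchIn-punchOut i≢j) ⟩
    _  ∎
    where j′ = punchOut i≢j

-- Injections and surjections between finite sets of equal size.

-- If `u` were missed, punching it out would give an injection into a set with one element fewer.
injective⇒surjective : (s : Fin n → Fin n) → Injective _≡_ _≡_ s → StrictlySurjective _≡_ s
injective⇒surjective {suc n} s inj u with any? (λ a → s a ≟ u)
... | yes p = p
... | no ¬p = contradiction (injective⇒≤ {f = λ a → punchOut (u≢s a)} λ eq →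
    inj (punchOut-injective (u≢s _) (u≢s _) eq)) 1+n≰n
  where
  u≢s : ∀ a → u ≢ s a
  u≢s a eq = ¬p (a , sym eq)

section-injective : {k : Fin n → Fin m} (surj : StrictlySurjective _≡_ k) → Injective _≡_ _≡_ (proj₁ ∘ surj)
section-injective {k = k} surj {a} {b} eq = trans (sym (proj₂ (surj a))) (trans (cong k eq) (proj₂ (surj b)))

-- A section of `k` is injective, hence surjective, hence a two-sided inverse.
surjective⇒injective : (k : Fin n → Fin n) → StrictlySurjective _≡_ k → Injective _≡_ _≡_ k
surjective⇒injective k surj {u} {v} ku≡kv = begin
  u                   ≡⟨ s∘k u ⟨
  proj₁ (surj (k u))  ≡⟨ cong (proj₁ ∘ surj) ku≡kv ⟩
  proj₁ (surj (k v))  ≡⟨ s∘k v ⟩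
  v                   ∎
  where
  open ≡-Reasoning
  s∘k : ∀ u → proj₁ (surj (k u)) ≡ u
  s∘k u with a , refl ← injective⇒surjective (proj₁ ∘ surj) (section-injective surj) u =
    cong (proj₁ ∘ surj) (proj₂ (surj a))

-- Homomorphism counts as sums, and categorical products.

E? : ∀ X u v → Dec (E X u v)
E? X u v = T? (Graph.adj X u v)

E-sym : ∀ X {u v} → E X u v → E X v u
E-sym X {u} {v} = subst T (Graph.adj-sym X u v)

maps : ∀ n X → List (Vec (V X) n)
maps n X = vecs (allFin (order X)) n

hom-∑ : ∀ F X → hom F X ≡ ∑ (maps (order F) X) (λ g → ⟦ isHom? F X (lookup g) ⟧)
hom-∑ F X = trans (length-filter _ (allFin (order X ^ order F)))
  (∑-finToFun (order X) (order F) (λ g → ⟦ isHom? F X g ⟧)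
    λ {g} {h} g≗h → ⟦⟧-cong (isHom? F X g) (isHom? F X h)
      (mk⇔ (λ p u v e → subst₂ (E X) (g≗h u) (g≗h v) (p u v e))
           (λ p u v e → subst₂ (E X) (sym (g≗h u)) (sym (g≗h v)) (p u v e))))

infixl 7 _⊗_
-- The categorical product. A loop requires loops in both factors, so the product with a simple `X`
-- is simple even when `K` has loops.
_⊗_ : Graph → Graph → Graph
X ⊗ K = record
  { order   = order X * order K
  ; adj     = λ p q → adj X (quot p) (quot q) ∧ adj K (rem p) (rem q)
  ; adj-sym = λ p q → cong₂ _∧_ (adj-sym X (quot p) (quot q)) (adj-sym K (rem p) (rem q))
  }
  where
  open Graph using (adj; adj-sym)
  quot : Fin (order X * order K) → Fin (order X)
  quot = quotient {order X} (order K)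
  rem : Fin (order X * order K) → Fin (order K)
  rem = remainder {order X} (order K)

⊗-simple : ∀ {X} → Simple X → ∀ K → Simple (X ⊗ K)
⊗-simple simple K p e = simple _ (proj₁ (to T-∧ e))

E-⊗ : ∀ X K {a b c d} → E (X ⊗ K) (combine a b) (combine c d) ⇔ (E X a c × E K b d)
E-⊗ X K {a} {b} {c} {d} = subst (λ t → T t ⇔ (E X a c × E K b d))
  (sym (cong₂ (λ p q → Graph.adj X (proj₁ p) (proj₁ q) ∧ Graph.adj K (proj₂ p) (proj₂ q))
    (remQuot-combine a b) (remQuot-combine c d)))
  T-∧

-- A map into the product is a pair of maps, and it is a homomorphism exactly when both components
-- are.
hom-⊗ : ∀ F X K → hom F (X ⊗ K) ≡ hom F X * hom F K
hom-⊗ F X K = begin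
  hom F (X ⊗ K)
    ≡⟨ hom-∑ F (X ⊗ K) ⟩
  ∑ (maps (order F) (X ⊗ K)) (λ w → ⟦ isHom? F (X ⊗ K) (lookup w) ⟧)
    ≡⟨ ∑-vecs-* {n = order F} (order X) (order K) _ ⟩
  ∑ (maps (order F) X) (λ v → ∑ (maps (order F) K) (λ w → ⟦ isHom? F (X ⊗ K) (lookup (zipWith combine v w)) ⟧))
    ≡⟨ ∑-cong (maps (order F) X) (λ v → ∑-cong (maps (order F) K) (λ w → pointwise v w)) ⟩
  ∑ (maps (order F) X) (λ v → ∑ (maps (order F) K) (λ w → ⟦ isHom? F X (lookup v) ⟧ * ⟦ isHom? F K (lookup w) ⟧))
    ≡⟨ ∑-cong (maps (order F) X) (λ v → ∑-*ˡ ⟦ isHom? F X (lookup v) ⟧ (maps (order F) K) _) ⟩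
  ∑ (maps (order F) X) (λ v → ⟦ isHom? F X (lookup v) ⟧ * ∑ (maps (order F) K) (λ w → ⟦ isHom? F K (lookup w) ⟧))
    ≡⟨ ∑-*ʳ _ (maps (order F) X) _ ⟩
  ∑ (maps (order F) X) (λ v → ⟦ isHom? F X (lookup v) ⟧) * ∑ (maps (order F) K) (λ w → ⟦ isHom? F K (lookup w) ⟧)
    ≡⟨ cong₂ _*_ (hom-∑ F X) (hom-∑ F K) ⟨
  hom F X * hom F K  ∎
  where
  open ≡-Reasoning
  E-zip : ∀ v w x y → E (X ⊗ K) (lookup (zipWith combine v w) x) (lookup (zipWith combine v w) y)
                    ⇔ (E X (lookup v x) (lookup v y) × E K (lookup w x) (lookup w y))
  E-zip v w x y rewrite lookup-zipWith combine x v w | lookup-zipWith combine y v w = E-⊗ X K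
  pointwise : ∀ v w → ⟦ isHom? F (X ⊗ K) (lookup (zipWith combine v w)) ⟧
                    ≡ ⟦ isHom? F X (lookup v) ⟧ * ⟦ isHom? F K (lookup w) ⟧
  pointwise v w = trans
    (⟦⟧-cong (isHom? F (X ⊗ K) _) (isHom? F X (lookup v) ×-dec isHom? F K (lookup w)) (mk⇔
      (λ p → (λ x y e → proj₁ (to (E-zip v w x y) (p x y e))) , (λ x y e → proj₂ (to (E-zip v w x y) (p x y e))))
      (λ (p , q) x y e → from (E-zip v w x y) (p x y e , q x y e))))
    (⟦⟧-× (isHom? F X (lookup v)) (isHom? F K (lookup w)))

-- Complements.

T-not-isYes : ∀ {P : Set} (P? : Dec P) → T (not (isYes P?)) ⇔ (¬ P)
T-not-isYes (yes p) = mk⇔ (λ ()) (λ ¬p → ¬p p)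
T-not-isYes (no ¬p) = mk⇔ (λ _ → ¬p) _

T-not : ∀ b → T (not b) ⇔ (¬ T b)
T-not true  = mk⇔ (λ ()) (λ ¬t → ¬t _)
T-not false = mk⇔ (λ _ ()) _

E-complement : ∀ X {u v} → E (complement X) u v ⇔ (u ≢ v × ¬ E X u v)
E-complement X {u} {v} = mk⇔
  (λ e → let (p , q) = to T-∧ e in to (T-not-isYes (u ≟ v)) p , to (T-not _) q)
  (λ (p , q) → from T-∧ (from (T-not-isYes (u ≟ v)) p , from (T-not _) q))

complement-simple : ∀ X → Simple (complement X)
complement-simple X u e = proj₁ (to (E-complement X) e) refl

-- Complementing always removes loops, so `X` must have none. The identity map is an isomorphism,
-- which suffices because a logic is isomorphism-invariant.
complement-involutive : ∀ {X} → Simple X → X ≅ complement (complement X)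
complement-involutive {X} simple = record
  { bijection = ↔-id (V X)
  ; preserves = λ u v → mk⇔
      (λ e → from (E-complement (complement X))
        ((λ { refl → simple u e }) , λ ē → proj₂ (to (E-complement X) ē) e))
      (λ e → let (u≢v , ¬ē) = to (E-complement (complement X)) e in
        decidable-stable (E? X u v) λ ¬e → ¬ē (from (E-complement X) (u≢v , ¬e)))
  }

-- Palettes: graphs on subsets of the colours.

lookup-injective : {xs : List A} → Unique xs → Injective _≡_ _≡_ (List.lookup xs)
lookup-injective (_ ∷ _)    {zero}  {zero}  _  = refl
lookup-injective (x∉ ∷ _)   {zero}  {suc j} eq = contradiction eq (All.lookup x∉ (∈-lookup j))
lookup-injective (x∉ ∷ _)   {suc i} {zero}  eq = contradiction (sym eq) (All.lookup x∉ (∈-lookup i))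
lookup-injective (_ ∷ uniq) {suc i} {suc j} eq = cong suc (lookup-injective uniq eq)

map-lookup-allFin : (xs : List A) → map (List.lookup xs) (allFin (length xs)) ≡ xs
map-lookup-allFin xs = trans (map-tabulate id (List.lookup xs)) (tabulate-lookup xs)

T-does : {P : Set ℓ} (P? : Dec P) → T (does P?) ⇔ P
T-does (yes p) = mk⇔ (λ _ → p) _
T-does (no ¬p) = mk⇔ (λ ()) ¬p

_≟₂_ : DecidableEquality (Fin m × Fin m)
_≟₂_ = ×-≡-dec _≟_ _≟_

-- Every graph on a subset of the m colours arises as a palette: S lists the colours that are left out and B the pairs
-- that are joined.
module Palette {m : ℕ} (S : List (Fin m)) (B : List (Fin m × Fin m)) where

  Kept : Fin m → Set
  Kept a = All (a ≢_) S

  kept? : ∀ a → Dec (Kept a)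
  kept? a = All.all? (λ s → ¬? (a ≟ s)) S

  colours : List (Fin m)
  colours = filter kept? (allFin m)

  colour : Fin (length colours) → Fin m
  colour = List.lookup colours

  colour-injective : Injective _≡_ _≡_ colour
  colour-injective = lookup-injective (filter⁺ kept? (allFin⁺ m))

  Joined : Fin m → Fin m → Set
  Joined a b = (a , b) ∈ₗ B ⊎ (b , a) ∈ₗ B

  joined? : ∀ a b → Dec (Joined a b)
  joined? a b = _∈?_ _≟₂_ (a , b) B ⊎-dec _∈?_ _≟₂_ (b , a) B

  palette : Graph
  palette = record
    { order   = length colours
    ; adj     = λ i j → does (joined? (colour i) (colour j))
    ; adj-sym = λ i j → ∨-comm (does (_∈?_ _≟₂_ (colour i , colour j) B)) _
    }

  E-palette : ∀ {i j} → E palette i j ⇔ Joined (colour i) (colour j)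
  E-palette {i} {j} = T-does (joined? (colour i) (colour j))

-- Homomorphisms into complements of products, as pairs of a colouring and a map.

module Colouring (F : Graph) (m : ℕ) where

  -- Adjacent vertices of a complement are distinct, so no edge of `F` may be collapsed by both
  -- components at once.
  Proper : ∀ X → Vec (Fin m) (order F) → Vec (V X) (order F) → Set
  Proper X k g = ∀ u v → E F u v → ¬ (lookup k u ≡ lookup k v × lookup g u ≡ lookup g v)

  proper? : ∀ X k g → Dec (Proper X k g)
  proper? X k g = all? λ u → all? λ v → E? F u v →-dec
    ¬? ((lookup k u ≟ lookup k v) ×-dec (lookup g u ≟ lookup g v))

  -- A homomorphism to the complement must leave every joined pair of colours uncovered;
  -- inclusion-exclusion later turns this into pairs that have to be covered.
  Covers : ∀ X → Vec (Fin m) (order F) → Vec (V X) (order F) → Fin m × Fin m → Set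
  Covers X k g (a , b) = ∃[ u ] ∃[ v ]
    lookup k u ≡ a × lookup k v ≡ b × E F u v × E X (lookup g u) (lookup g v)

  covers? : ∀ X k g t → Dec (Covers X k g t)
  covers? X k g (a , b) = any? λ u → any? λ v →
    (lookup k u ≟ a) ×-dec (lookup k v ≟ b) ×-dec E? F u v ×-dec E? X (lookup g u) (lookup g v)

  Hits : Vec (Fin m) (order F) → Fin m → Set
  Hits k a = ∃[ u ] lookup k u ≡ a

  hits? : ∀ k a → Dec (Hits k a)
  hits? k a = any? λ u → lookup k u ≟ a

  colourings : List (Vec (Fin m) (order F))
  colourings = vecs (allFin m) (order F)

  configurations : ∀ X → List (Vec (Fin m) (order F) × Vec (V X) (order F))
  configurations X = cartesianProduct colourings (maps (order F) X)

  ∑-configurations : ∀ X f → ∑ (configurations X) f ≡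
    ∑ colourings (λ k → ∑ (maps (order F) X) (λ g → f (k , g)))
  ∑-configurations X f = ∑-cartesianProductWith _,_ colourings (maps (order F) X) f

  module _ (X : Graph) (S : List (Fin m)) (B : List (Fin m × Fin m)) where
    open Palette S B

    private
      Good : Vec (Fin m) (order F) → Vec (V X) (order F) → Set
      Good k g = Proper X k g × All (λ t → ¬ Covers X k g t) B

      good? : ∀ k g → Dec (Good k g)
      good? k g = proper? X k g ×-dec All.all? (λ t → ¬? (covers? X k g t)) B

      -- The colouring `κ` takes values in positions of the list `colours`. Translating them by the
      -- injective `colour` neither creates nor removes collapsed edges.
      isHom⇔Good : ∀ g κ → IsHom F (complement (X ⊗ palette)) (lookup (zipWith combine g κ))
                         ⇔ Good (Vec.map colour κ) g
      isHom⇔Good g κ = mk⇔ fwd bwd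
        where
        h : V F → V (X ⊗ palette)
        h = lookup (zipWith combine g κ)
        h≡ : ∀ u → h u ≡ combine (lookup g u) (lookup κ u)
        h≡ u = lookup-zipWith combine u g κ
        c≡ : ∀ u → lookup (Vec.map colour κ) u ≡ colour (lookup κ u)
        c≡ u = lookup-map u colour κ
        E-h : ∀ u v → E (X ⊗ palette) (h u) (h v) ⇔
              (E X (lookup g u) (lookup g v) × Joined (colour (lookup κ u)) (colour (lookup κ v)))
        E-h u v = mk⇔
          (λ e → let (p , q) = to (E-⊗ X palette) (subst₂ (E (X ⊗ palette)) (h≡ u) (h≡ v) e) in p , to E-palette q)
          (λ (p , q) → subst₂ (E (X ⊗ palette)) (sym (h≡ u)) (sym (h≡ v))
            (from (E-⊗ X palette) (p , from E-palette q)))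
        fwd : IsHom F (complement (X ⊗ palette)) h → Good (Vec.map colour κ) g
        fwd hom =
          (λ u v e (ku≡kv , gu≡gv) →
            let κu≡κv = colour-injective (trans (sym (c≡ u)) (trans ku≡kv (c≡ v))) in
            proj₁ (to (E-complement (X ⊗ palette)) (hom u v e))
              (trans (h≡ u) (trans (cong₂ combine gu≡gv κu≡κv) (sym (h≡ v))))) ,
          All.tabulate λ { t∈B (u , v , refl , refl , e , e′) →
            proj₂ (to (E-complement (X ⊗ palette)) (hom u v e))
              (from (E-h u v) (e′ , inj₁ (subst₂ (λ a b → (a , b) ∈ₗ B) (c≡ u) (c≡ v) t∈B))) }
        bwd : Good (Vec.map colour κ) g → IsHom F (complement (X ⊗ palette)) h
        bwd (proper , none) u v e = from (E-complement (X ⊗ palette))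
          ( (λ hu≡hv →
              let (gu≡gv , κu≡κv) = combine-injective _ (lookup κ u) _ _ (trans (sym (h≡ u)) (trans hu≡hv (h≡ v))) in
              proper u v e (trans (c≡ u) (trans (cong colour κu≡κv) (sym (c≡ v))) , gu≡gv))
          , λ e′ → let (p , q) = to (E-h u v) e′ in
              [ (λ t∈B → All.lookup none t∈B (u , v , c≡ u , c≡ v , e , p))
              -- `B` lists ordered pairs but joins them symmetrically, so for the reversed pair the
              -- edge of `F` is read backwards.
              , (λ t∈B → All.lookup none t∈B (v , u , c≡ v , c≡ u , E-sym F e , E-sym X p)) ]′ q)

    -- Brings all palettes to one index set: colourings by the palette become colourings by all `m`
    -- colours that avoid `S`. Then `S` and `B` enter only through products of indicators, the form
    -- that inclusion-exclusion takes.
    hom-complement-⊗ : hom F (complement (X ⊗ palette)) ≡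
      ∑ (configurations X) (λ (k , g) →
        ⟦ proper? X k g ⟧ * ∏ B (λ t → ⟦ ¬? (covers? X k g t) ⟧) * ∏ S (λ a → ⟦ ¬? (hits? k a) ⟧))
    hom-complement-⊗ = begin
      hom F (complement (X ⊗ palette))
        ≡⟨ hom-∑ F (complement (X ⊗ palette)) ⟩
      _ ≡⟨ ∑-vecs-* {n = order F} (order X) (length colours) _ ⟩
      _ ≡⟨ ∑-cong gs (λ g → ∑-cong (maps (order F) palette) (λ κ →
             ⟦⟧-cong (isHom? F (complement (X ⊗ palette)) _) (good? (Vec.map colour κ) g) (isHom⇔Good g κ))) ⟩
      _ ≡⟨ ∑-cong gs (λ g → ∑-vecs-map colour (allFin (length colours)) (λ k → ⟦ good? k g ⟧)) ⟨
      _ ≡⟨ ∑-cong gs (λ g → cong (λ L → ∑ (vecs L (order F)) (λ k → ⟦ good? k g ⟧)) (map-lookup-allFin colours)) ⟩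
      _ ≡⟨ ∑-cong gs (λ g → ∑-vecs-filter kept? (allFin m) (λ k → ⟦ good? k g ⟧)) ⟩
      _ ≡⟨ ∑-swap gs colourings _ ⟩
      _ ≡⟨ ∑-cong colourings (λ k → ∑-cong gs (λ g → pointwise k g)) ⟩
      _ ≡⟨ ∑-configurations X _ ⟨
      _ ∎
      where
      open ≡-Reasoning
      gs = maps (order F) X
      kept⇔ : ∀ k → VAll.All Kept k ⇔ All (λ a → ¬ Hits k a) S
      kept⇔ k = mk⇔
        (λ kept → All.tabulate λ { s∈S (u , refl) → All.lookup (lookup⁺ kept u) s∈S refl })
        (λ avoid → lookup⁻ λ u → All.tabulate λ s∈S ku≡s → All.lookup avoid s∈S (u , ku≡s))
      pointwise : ∀ k g → ⟦ VAll.all? kept? k ⟧ * ⟦ good? k g ⟧ ≡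
        ⟦ proper? X k g ⟧ * ∏ B (λ t → ⟦ ¬? (covers? X k g t) ⟧) * ∏ S (λ a → ⟦ ¬? (hits? k a) ⟧)
      pointwise k g = trans (*-comm ⟦ VAll.all? kept? k ⟧ _) (cong₂ _*_
        (trans (⟦⟧-× (proper? X k g) (All.all? (λ t → ¬? (covers? X k g t)) B))
               (cong (⟦ proper? X k g ⟧ *_) (sym (∏-⟦⟧ (λ t → ¬? (covers? X k g t)) B))))
        (trans (⟦⟧-cong (VAll.all? kept? k) (All.all? (λ a → ¬? (hits? k a)) S) (kept⇔ k))
               (sym (∏-⟦⟧ (λ a → ¬? (hits? k a)) S))))

  Surjective : Vec (Fin m) (order F) → Set
  Surjective k = ∀ a → Hits k a

  surjective? : ∀ k → Dec (Surjective k)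
  surjective? k = all? (hits? k)

  properSurjections : List (Fin m × Fin m) → Graph → ℕ
  properSurjections T X = ∑ colourings λ k → ⟦ surjective? k ⟧ *
    ∑ (maps (order F) X) λ g → ⟦ proper? X k g ⟧ * ⟦ All.all? (covers? X k g) T ⟧

  -- Two nested inclusion-exclusions. The inner one trades missed colours for hit ones, the outer
  -- one uncovered pairs for covered ones; the hypothesis is applied to every palette.
  properSurjections-≡ : ∀ {G H} →
    (∀ K → hom F (complement (G ⊗ K)) ≡ hom F (complement (H ⊗ K))) →
    ∀ T → properSurjections T G ≡ properSurjections T H
  properSurjections-≡ {G} {H} hyp T = begin
    properSurjections T G  ≡⟨ unfold G ⟨
    Φ G                    ≡⟨ inclusion-exclusion configurations
                                (λ t {X} (k , g) → ⟦ covers? X k g t ⟧)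
                                (λ t {X} (k , g) → ⟦ ¬? (covers? X k g t) ⟧)
                                (λ t {X} (k , g) → ⟦⟧-¬ (covers? X k g t))
                                (λ {X} (k , g) → ⟦ proper? X k g ⟧ * ∏ (allFin m) (λ a → ⟦ hits? k a ⟧))
                                {G} {H} step T ⟩
    Φ H                    ≡⟨ unfold H ⟩
    properSurjections T H  ∎
    where
    open ≡-Reasoning
    Φ : Graph → ℕ
    Φ X = ∑ (configurations X) λ (k , g) →
      ⟦ proper? X k g ⟧ * ∏ (allFin m) (λ a → ⟦ hits? k a ⟧) * ∏ T (λ t → ⟦ covers? X k g t ⟧)

    step : ∀ B → ∑ (configurations G) _ ≡ ∑ (configurations H) _
    step B = begin
      _ ≡⟨ ∑-cong (configurations G) (λ (k , g) → xy∙z≈xz∙y ⟦ proper? G k g ⟧ _ _) ⟩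
      _ ≡⟨ inclusion-exclusion configurations
             (λ a (k , g) → ⟦ hits? k a ⟧)
             (λ a (k , g) → ⟦ ¬? (hits? k a) ⟧)
             (λ a (k , g) → ⟦⟧-¬ (hits? k a))
             (λ {X} (k , g) → ⟦ proper? X k g ⟧ * ∏ B (λ t → ⟦ ¬? (covers? X k g t) ⟧))
             {G} {H} (λ S → trans (sym (hom-complement-⊗ G S B))
               (trans (hyp (Palette.palette S B)) (hom-complement-⊗ H S B)))
             -- Requiring all `m` colours to be hit makes the colouring surjective.
             (allFin m) ⟩
      _ ≡⟨ ∑-cong (configurations H) (λ (k , g) → xy∙z≈xz∙y ⟦ proper? H k g ⟧ _ _) ⟩
      _ ∎

    unfold : ∀ X → Φ X ≡ properSurjections T X
    unfold X = trans (∑-configurations X _) (∑-cong colourings λ k → trans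
      (∑-cong (maps (order F) X) λ g → pointwise k g) (∑-*ˡ ⟦ surjective? k ⟧ (maps (order F) X) _))
      where
      pointwise : ∀ k g → ⟦ proper? X k g ⟧ * ∏ (allFin m) (λ a → ⟦ hits? k a ⟧) * ∏ T (λ t → ⟦ covers? X k g t ⟧)
        ≡ ⟦ surjective? k ⟧ * (⟦ proper? X k g ⟧ * ⟦ All.all? (covers? X k g) T ⟧)
      pointwise k g = trans (cong₂ (λ p q → ⟦ proper? X k g ⟧ * p * q)
          (trans (∏-⟦⟧ (hits? k) (allFin m)) (⟦⟧-cong (All.all? (hits? k) (allFin m)) (surjective? k)
            (mk⇔ (λ all a → All.lookup all (∈-allFin a)) (λ surj → All.tabulate λ {a} _ → surj a))))
          (∏-⟦⟧ (covers? X k g) T))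
        (trans (cong (_* ⟦ All.all? (covers? X k g) T ⟧) (*-comm ⟦ proper? X k g ⟧ ⟦ surjective? k ⟧))
               (*-assoc ⟦ surjective? k ⟧ _ _))

-- Positivity, splitting of sums, and cancellation of powers.

∑-mono : (xs : List A) {f g : A → ℕ} → (∀ x → f x ≤ g x) → ∑ xs f ≤ ∑ xs g
∑-mono []       f≤g = z≤n
∑-mono (x ∷ xs) f≤g = +-mono-≤ (f≤g x) (∑-mono xs f≤g)

⟦⟧-*-≤ : {P : Set ℓ} (P? : Dec P) (x : ℕ) → ⟦ P? ⟧ * x ≤ x
⟦⟧-*-≤ (yes _) x = ≤-reflexive (*-identityˡ x)
⟦⟧-*-≤ (no _)  x = z≤n

∑-split : (xs : List A) (p p̄ f : A → ℕ) → (∀ x → p x + p̄ x ≡ 1) →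
          ∑ xs f ≡ ∑ xs (λ x → p x * f x) + ∑ xs (λ x → p̄ x * f x)
∑-split xs p p̄ f p+p̄≡1 = trans
  (∑-cong xs λ x → trans (sym (*-identityˡ (f x)))
    (trans (cong (_* f x) (sym (p+p̄≡1 x))) (*-distribʳ-+ (f x) (p x) (p̄ x))))
  (∑-+ xs _ _)

∑-weighted : (xs : List A) (w f g : A → ℕ) (c : ℕ) →
             ∑ xs (λ x → w x * (f x + g x * c)) ≡ ∑ xs (λ x → w x * f x) + ∑ xs (λ x → w x * g x) * c
∑-weighted xs w f g c = trans
  (∑-cong xs λ x → trans (*-distribˡ-+ (w x) (f x) (g x * c)) (cong (w x * f x +_) (sym (*-assoc (w x) (g x) c))))
  (trans (∑-+ xs _ _) (cong (∑ xs (λ x → w x * f x) +_) (∑-*ʳ c xs _)))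

-- Makes the multiplicities cancellable: exhibiting one map of weight 1 is enough.
∑-vecs-nonZero : (v : Vec (Fin m) n) {f : Vec (Fin m) n → ℕ} → f v ≡ 1 → NonZero (∑ (vecs (allFin m) n) f)
∑-vecs-nonZero {m} {n} v {f} fv≡1 = >-nonZero (begin
  1                                                  ≡⟨ fv≡1 ⟨
  f v                                                ≡⟨ ∑-vecs-δ v f ⟨
  ∑ (vecs (allFin m) n) (λ w → ⟦ w ≟ᵥ v ⟧ * f w)     ≤⟨ ∑-mono (vecs (allFin m) n) (λ w → ⟦⟧-*-≤ (w ≟ᵥ v) (f w)) ⟩
  ∑ (vecs (allFin m) n) f                            ∎)
  where open ≤-Reasoning

length-allFin : ∀ n → length (allFin n) ≡ n
length-allFin n = length-tabulate id

∑-maps-1 : ∀ n X → ∑ (maps n X) (λ _ → 1) ≡ order X ^ n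
-- All maps restrict to the unique map on the empty set, so this is `∑-reindex` along the empty
-- injection.
∑-maps-1 n X = trans (∑-reindex {m = 0} {n = n} (λ ()) (λ { {()} }) (allFin (order X)) (λ _ → 1))
  (trans (*-identityʳ _) (cong (_^ n) (length-allFin (order X))))

^-cancelʳ-≡ : ∀ n .{{_ : NonZero n}} {a b} → a ^ n ≡ b ^ n → a ≡ b
^-cancelʳ-≡ n {a} {b} eq with <-cmp a b
... | tri< a<b _ _ = contradiction eq (<⇒≢ (^-monoˡ-< n a<b))
... | tri≈ _ a≡b _ = a≡b
... | tri> _ _ b<a = contradiction (sym eq) (<⇒≢ (^-monoˡ-< n b<a))

-- Surjections onto one element fewer, and edge contractions.

module _ {k : Fin (suc n) → Fin m} {u v : Fin (suc n)} (u≢v : u ≢ v) (ku≡kv : k u ≡ k v) where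

  -- The point `v` is redundant, as `u` has the same values; `punchIn v` enumerates the remaining
  -- points.
  avoid : (g : Fin (suc n) → A) → g u ≡ g v → ∀ x →
          ∃[ x′ ] (k (punchIn v x′) ≡ k x × g (punchIn v x′) ≡ g x)
  avoid g gu≡gv x with v ≟ x
  ... | no v≢x   = punchOut v≢x , cong k (punchIn-punchOut v≢x) , cong g (punchIn-punchOut v≢x)
  ... | yes refl = punchOut v≢u , trans (cong k (punchIn-punchOut v≢u)) ku≡kv
                                   , trans (cong g (punchIn-punchOut v≢u)) gu≡gv
    where v≢u = u≢v ∘ sym

  avoid-surjective : StrictlySurjective _≡_ k → StrictlySurjective _≡_ (k ∘ punchIn v)
  avoid-surjective surj a with x , refl ← surj a = let (x′ , eq , _) = avoid k ku≡kv x in x′ , eq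

-- A surjection onto one element fewer has a single nontrivial fibre, of size two.
collapse : {k : Fin n → Fin m} → n ≡ suc m → StrictlySurjective _≡_ k → ∀ {u v} → u ≢ v → k u ≡ k v →
           (g : Fin n → A) → g u ≡ g v → ∀ x y → k x ≡ k y → g x ≡ g y
collapse {k = k} refl surj {u} {v} u≢v ku≡kv g gu≡gv x y kx≡ky
  with x′ , kx′ , gx′ ← avoid u≢v ku≡kv g gu≡gv x
     | y′ , ky′ , gy′ ← avoid u≢v ku≡kv g gu≡gv y
  -- Without `v`, the map `k` is a surjection between sets of equal size, so the representatives of
  -- `x` and `y` coincide.
  with refl ← surjective⇒injective (k ∘ punchIn v) (avoid-surjective u≢v ku≡kv surj)
                (trans kx′ (trans kx≡ky (sym ky′)))
  = trans (sym gx′) gy′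

-- Once `v` is deleted, `proj` is still surjective, and it has become injective because only `u` and
-- `v` were identified.
contraction-order : ∀ {F F′} → Simple F → Contracts F F′ → order F ≡ suc (order F′)
contraction-order {F} {F′} simple c = go (Contracts.proj c) (Contracts.surjective c) u≢v
    (from (identifies u v) (inj₂ (inj₁ (refl , refl)))) (λ x y → to (identifies x y))
  where
  open Contracts c using (u; v; edge; identifies)
  u≢v : u ≢ v
  u≢v u≡v = simple u (subst (E F u) (sym u≡v) edge)
  -- The sizes are generalised to variables so that `n` can be matched as a successor.
  go : ∀ {n m} (k : Fin n → Fin m) → StrictlySurjective _≡_ k → ∀ {u v} → u ≢ v → k u ≡ k v →
       (∀ x y → k x ≡ k y → x ≡ y ⊎ (x ≡ u × y ≡ v) ⊎ (x ≡ v × y ≡ u)) → n ≡ suc m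
  go {suc n} k surj {u} {v} u≢v ku≡kv ident = cong suc (≤-antisym
      (injective⇒≤ inj)
      (injective⇒≤ (section-injective (avoid-surjective u≢v ku≡kv surj))))
    where
    inj : Injective _≡_ _≡_ (k ∘ punchIn v)
    inj {i} {j} eq with ident _ _ eq
    ... | inj₁ p               = punchIn-injective v i j p
    ... | inj₂ (inj₁ (_ , q))  = contradiction q (punchInᵢ≢i v j)
    ... | inj₂ (inj₂ (p , _))  = contradiction p (punchInᵢ≢i v i)

-- Maps preserving a prescribed list of edges.

Adjacent : ∀ X → Vec (V X) n → Fin n × Fin n → Set
Adjacent X g (a , b) = E X (lookup g a) (lookup g b)

adjacent? : ∀ X (g : Vec (V X) n) t → Dec (Adjacent X g t)
adjacent? X g (a , b) = E? X (lookup g a) (lookup g b)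

-- The homomorphism count of the graph on `Fin n` with edges `T`, where a bare list of pairs stands
-- for the graph.
edgeMaps : List (Fin n × Fin n) → Graph → ℕ
edgeMaps {n} T X = ∑ (maps n X) λ g → ⟦ All.all? (adjacent? X g) T ⟧

allPairs : ∀ n → List (Fin n × Fin n)
allPairs n = cartesianProduct (allFin n) (allFin n)

edges : ∀ F → List (V F × V F)
edges F = filter (λ (u , v) → E? F u v) (allPairs (order F))

∈-edges : ∀ F {u v} → (u , v) ∈ₗ edges F ⇔ E F u v
∈-edges F = mk⇔ (proj₂ ∘ ∈-filter⁻ (λ (u , v) → E? F u v) {xs = allPairs (order F)})
  (∈-filter⁺ (λ (u , v) → E? F u v) (∈-cartesianProduct⁺ (∈-allFin _) (∈-allFin _)))

hom-edgeMaps : ∀ F X → hom F X ≡ edgeMaps (edges F) X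
hom-edgeMaps F X = trans (hom-∑ F X) (∑-cong (maps (order F) X) λ g →
  ⟦⟧-cong (isHom? F X (lookup g)) (All.all? (adjacent? X g) (edges F)) (mk⇔
    (λ p → All.tabulate λ { {u , v} e → p u v (to (∈-edges F) e) })
    (λ all u v e → All.lookup all (from (∈-edges F) e))))

module Factoring (F : Graph) (m : ℕ) where
  open Colouring F m public

  Coverable : Vec (Fin m) (order F) → Fin m × Fin m → Set
  Coverable k (a , b) = ∃[ u ] ∃[ v ] (lookup k u ≡ a × lookup k v ≡ b × E F u v)

  coverable? : ∀ k t → Dec (Coverable k t)
  coverable? k (a , b) = any? λ u → any? λ v → (lookup k u ≟ a) ×-dec (lookup k v ≟ b) ×-dec E? F u v

  -- A map that respects `k` is some `g′` after `k`. It covers `(a , b)` exactly when an edge of `F`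
  -- lies over this pair and `g′` sends it to an edge of `X`: one condition on `k` alone and one on
  -- `g′` alone.
  ∑-respects-covers : ∀ X T k → Surjective k →
    ∑ (maps (order F) X) (λ g → ⟦ respects? (lookup k) g ⟧ * ⟦ All.all? (covers? X k g) T ⟧) ≡
    ⟦ All.all? (coverable? k) T ⟧ * edgeMaps T X
  ∑-respects-covers X T k surj = begin
    _ ≡⟨ ∑-respects (lookup k) surj (λ g → ⟦ All.all? (covers? X k g) T ⟧) ⟩
    _ ≡⟨ ∑-cong (maps m X) (λ g → trans
           (⟦⟧-cong (All.all? (covers? X k (reindex (lookup k) g)) T)
             (All.all? (coverable? k) T ×-dec All.all? (adjacent? X g) T) (covers⇔ g))
           (⟦⟧-× (All.all? (coverable? k) T) (All.all? (adjacent? X g) T))) ⟩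
    _ ≡⟨ ∑-*ˡ ⟦ All.all? (coverable? k) T ⟧ (maps m X) _ ⟩
    _ ∎
    where
    open ≡-Reasoning
    covers⇔ : ∀ g → All (Covers X k (reindex (lookup k) g)) T ⇔ (All (Coverable k) T × All (Adjacent X g) T)
    covers⇔ g = mk⇔
      (λ all → All.map (λ { {a , b} (u , v , p , q , e , _) → u , v , p , q , e }) all
             , All.map (λ { {a , b} (u , v , refl , refl , _ , e) →
                 subst₂ (E X) (lookup-reindex (lookup k) g u) (lookup-reindex (lookup k) g v) e }) all)
      (λ (all , adj) → All.zipWith (λ { {a , b} ((u , v , refl , refl , e) , e′) → u , v , refl , refl , e ,
                 subst₂ (E X) (sym (lookup-reindex (lookup k) g u)) (sym (lookup-reindex (lookup k) g v)) e′ })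
        (all , adj))

-- Counting homomorphisms from subgraphs.

module _ (F G H : Graph) (F-simple : Simple F)
         (hyp : ∀ K → hom F (complement (G ⊗ K)) ≡ hom F (complement (H ⊗ K))) where

  -- With as many colours as vertices, a surjective `k` is bijective: it collapses no edge of the
  -- simple graph `F`, and every `g` factors through it. The count is thus `edgeMaps T X` times a
  -- multiplicity independent of `X`, positive because the identity colouring contributes.
  edgeMaps-≡ : ∀ T → All (uncurry (E F)) T → edgeMaps T G ≡ edgeMaps T H
  edgeMaps-≡ T T⊆E = *-cancelˡ-≡ (edgeMaps T G) (edgeMaps T H) automorphisms
    (trans (sym (factor G)) (trans (properSurjections-≡ {G} {H} hyp T) (factor H)))
    where
    open Factoring F (order F)
    -- Bijections of `V F` for which every pair in `T` is the image of an edge; these are the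
    -- automorphisms of `F` when `T` is `edges F`.
    automorphisms : ℕ
    automorphisms = ∑ colourings λ k → ⟦ surjective? k ⟧ * ⟦ All.all? (coverable? k) T ⟧

    factor : ∀ X → properSurjections T X ≡ automorphisms * edgeMaps T X
    factor X = trans (∑-cong colourings λ k → trans
        (⟦⟧-*-cong (surjective? k) λ surj → trans
          (∑-cong (maps (order F) X) λ g → cong (_* ⟦ All.all? (covers? X k g) T ⟧) (proper≡respects k g surj))
          (∑-respects-covers X T k surj))
        (sym (*-assoc ⟦ surjective? k ⟧ _ _)))
      (∑-*ʳ (edgeMaps T X) colourings _)
      where
      proper≡respects : ∀ k g → Surjective k → ⟦ proper? X k g ⟧ ≡ ⟦ respects? (lookup k) g ⟧
      proper≡respects k g surj = trans
        (⟦⟧-yes (proper? X k g) λ u v e (ku≡kv , _) → F-simple u (subst (E F u) (sym (inj ku≡kv)) e))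
        (sym (⟦⟧-yes (respects? (lookup k) g) λ u v ku≡kv → cong (lookup g) (inj ku≡kv)))
        where
        inj : Injective _≡_ _≡_ (lookup k)
        inj = surjective⇒injective (lookup k) surj

    instance
      automorphisms-nonZero : NonZero automorphisms
      automorphisms-nonZero = ∑-vecs-nonZero (tabulate id)
        {λ k → ⟦ surjective? k ⟧ * ⟦ All.all? (coverable? k) T ⟧} (cong₂ _*_
        (⟦⟧-yes (surjective? (tabulate id)) λ a → a , lookup∘tabulate id a)
        (⟦⟧-yes (All.all? (coverable? (tabulate id)) T)
          (All.map (λ { {a , b} e → a , b , lookup∘tabulate id a , lookup∘tabulate id b , e }) T⊆E)))

  -- With no prescribed edges all maps are counted, and the root can be taken as soon as `F` has a
  -- vertex.
  order-≡ : .{{_ : NonZero (order F)}} → order G ≡ order H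
  order-≡ = ^-cancelʳ-≡ (order F) (begin
    order G ^ order F  ≡⟨ ∑-maps-1 (order F) G ⟨
    edgeMaps {order F} [] G  ≡⟨ edgeMaps-≡ [] [] ⟩
    edgeMaps {order F} [] H  ≡⟨ ∑-maps-1 (order F) H ⟩
    order H ^ order F  ∎)
    where open ≡-Reasoning

  private
    F-nonZero : ∀ a {d} → order F ∸ a ≡ suc d → NonZero (order F)
    F-nonZero a eq = ≢-nonZero λ F≡0 → 0≢1+n (trans (sym (0∸n≡0 a)) (trans (cong (_∸ a) (sym F≡0)) eq))

  -- A map on `V F` preserving the embedded edges of `M` is a homomorphism from `M` with free values
  -- on the other vertices. It remains to cancel the number of free choices.
  subgraph-hom-≡ : ∀ {M} → Subgraph M F → hom M G ≡ hom M H
  subgraph-hom-≡ {M} (h , h-inj , h-hom) = cancel (order F ∸ order M) refl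
    (trans (sym (factor G)) (trans (edgeMaps-≡ image image⊆E) (factor H)))
    where
    open ≡-Reasoning
    image : List (V F × V F)
    image = map (λ (a , b) → h a , h b) (edges M)

    image⊆E : All (uncurry (E F)) image
    image⊆E = All.tabulate λ t∈ → case ∈-map⁻ (λ (a , b) → h a , h b) t∈ of λ
      { ((a , b) , ab∈ , refl) → h-hom a b (to (∈-edges M) ab∈) }

    factor : ∀ X → edgeMaps image X ≡ order X ^ (order F ∸ order M) * hom M X
    factor X = begin
      edgeMaps image X
        ≡⟨ ∑-cong (maps (order F) X) (λ g →
             ⟦⟧-cong (All.all? (adjacent? X g) image) (isHom? M X (lookup (reindex h g))) (mk⇔
             (λ all a b e → subst₂ (E X) (sym (lookup-reindex h g a)) (sym (lookup-reindex h g b))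
               (All.lookup all (∈-map⁺ (λ (a , b) → h a , h b) (from (∈-edges M) e))))
             (λ p → All.tabulate λ t∈ → case ∈-map⁻ (λ (a , b) → h a , h b) t∈ of λ
               { ((a , b) , ab∈ , refl) → subst₂ (E X) (lookup-reindex h g a) (lookup-reindex h g b)
                   (p a b (to (∈-edges M) ab∈)) }))) ⟩
      ∑ (maps (order F) X) (λ g → ⟦ isHom? M X (lookup (reindex h g)) ⟧)
        ≡⟨ ∑-reindex h h-inj (allFin (order X)) (λ g → ⟦ isHom? M X (lookup g) ⟧) ⟩
      length (allFin (order X)) ^ (order F ∸ order M) * ∑ (maps (order M) X) (λ g → ⟦ isHom? M X (lookup g) ⟧)
        ≡⟨ cong₂ (λ a b → a ^ (order F ∸ order M) * b) (length-allFin (order X)) (sym (hom-∑ M X)) ⟩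
      order X ^ (order F ∸ order M) * hom M X  ∎

    hom-empty : ∀ X → order X ≡ 0 → hom M X ≡ order X ^ order M
    hom-empty X X≡0 = trans (hom-∑ M X) (trans
      (∑-cong (maps (order M) X) λ g → ⟦⟧-yes (isHom? M X (lookup g)) λ u v e →
        contradiction (subst Fin X≡0 (lookup g u)) ¬Fin0)
      (∑-maps-1 (order M) X))

    cancel : ∀ e → order F ∸ order M ≡ e →
      order G ^ (order F ∸ order M) * hom M G ≡ order H ^ (order F ∸ order M) * hom M H → hom M G ≡ hom M H
    cancel zero    d≡0 eq rewrite d≡0 = +-cancelʳ-≡ 0 _ _ eq
    cancel (suc d) d≡  eq with order G ≟ℕ 0
    -- With vertices of `F` left over and `G` empty, the factor is zero and cannot be cancelled.
    -- Then `H` is empty too, and all maps from `M` are vacuously homomorphisms.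
    ... | yes G≡0 = trans (hom-empty G G≡0)
        (trans (cong (_^ order M) G≡H) (sym (hom-empty H (trans (sym G≡H) G≡0))))
      where G≡H = order-≡ {{F-nonZero (order M) d≡}}
    ... | no G≢0 = *-cancelˡ-≡ _ _ (order G ^ e′) {{m^n≢0 (order G) e′ {{≢-nonZero G≢0}}}}
        (trans eq (cong (λ a → a ^ e′ * hom M H) (sym (order-≡ {{F-nonZero (order M) d≡}}))))
      where e′ = order F ∸ order M

  -- Counting homomorphisms from contractions.

  -- Inclusion–exclusion twice: first from kept to broken edges of F, then, since a pair of colours is uncovered when
  -- all edges of F over it are broken, from uncovered to covered pairs.
  coverMaps-≡ : ∀ {m} (k : Vec (Fin m) (order F)) T → let open Colouring F m in
    ∑ (maps (order F) G) (λ g → ⟦ All.all? (covers? G k g) T ⟧) ≡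
    ∑ (maps (order F) H) (λ g → ⟦ All.all? (covers? H k g) T ⟧)
  coverMaps-≡ {m} k T = begin
    _ ≡⟨ ∑-cong (maps (order F) G) (λ g → unit (covers? G k g) T) ⟨
    _ ≡⟨ inclusion-exclusion (maps (order F))
           (λ t {X} g → ⟦ covers? X k g t ⟧) (λ t {X} g → ⟦ ¬? (covers? X k g t) ⟧)
           (λ t {X} g → ⟦⟧-¬ (covers? X k g t)) (λ _ → 1) {G} {H} uncovered T ⟩
    _ ≡⟨ ∑-cong (maps (order F) H) (λ g → unit (covers? H k g) T) ⟩
    _ ∎
    where
    open ≡-Reasoning
    open Colouring F m

    unit : ∀ {I : Set} {P : I → Set} (P? : ∀ i → Dec (P i)) is → 1 * ∏ is (λ i → ⟦ P? i ⟧) ≡ ⟦ All.all? P? is ⟧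
    unit P? is = trans (*-identityˡ _) (∏-⟦⟧ P? is)

    keeps? : ∀ X (g : Vec (V X) (order F)) t → Dec (uncurry (E F) t → Adjacent X g t)
    keeps? X g t = uncurry (E? F) t →-dec adjacent? X g t

    -- Pairs that are not edges of `F` are kept vacuously; discarding them makes `edgeMaps-≡`
    -- applicable.
    keeps-edgeMaps : ∀ X S → ∑ (maps (order F) X) (λ g → 1 * ∏ S (λ t → ⟦ keeps? X g t ⟧)) ≡
                     edgeMaps (filter (uncurry (E? F)) S) X
    keeps-edgeMaps X S = ∑-cong (maps (order F) X) λ g → trans (unit (keeps? X g) S)
      (⟦⟧-cong (All.all? (keeps? X g) S) (All.all? (adjacent? X g) (filter (uncurry (E? F)) S)) (mk⇔
        (λ all → All.tabulate λ t∈ → let (t∈S , e) = ∈-filter⁻ (uncurry (E? F)) {xs = S} t∈ in All.lookup all t∈S e)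
        (λ all → All.tabulate λ t∈S e → All.lookup all (∈-filter⁺ (uncurry (E? F)) t∈S e))))

    over? : ∀ S t → Dec (uncurry (E F) t × (lookup k (proj₁ t) , lookup k (proj₂ t)) ∈ₗ S)
    over? S (u , v) = E? F u v ×-dec _∈?_ _≟₂_ (lookup k u , lookup k v) S

    over : List (Fin m × Fin m) → List (V F × V F)
    over S = filter (over? S) (allPairs (order F))

    uncovered⇔broken : ∀ X g S →
      All (λ t → ¬ Covers X k g t) S ⇔ All (λ t → ¬ (uncurry (E F) t → Adjacent X g t)) (over S)
    uncovered⇔broken X g S = mk⇔
      (λ none → All.tabulate λ { {u , v} t∈ keeps →
        let (_ , e , t∈S) = ∈-filter⁻ (over? S) {xs = allPairs (order F)} t∈ in
        All.lookup none t∈S (u , v , refl , refl , e , keeps e) })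
      (λ all → All.tabulate λ { t∈S (u , v , refl , refl , e , e′) →
        All.lookup all (∈-filter⁺ (over? S) (∈-cartesianProduct⁺ (∈-allFin u) (∈-allFin v)) (e , t∈S)) (λ _ → e′) })

    ∑-uncovered : ∀ X S → ∑ (maps (order F) X) (λ g → 1 * ∏ S (λ t → ⟦ ¬? (covers? X k g t) ⟧)) ≡
                          ∑ (maps (order F) X) (λ g → 1 * ∏ (over S) (λ t → ⟦ ¬? (keeps? X g t) ⟧))
    ∑-uncovered X S = ∑-cong (maps (order F) X) λ g → trans (unit (λ t → ¬? (covers? X k g t)) S) (trans
      (⟦⟧-cong (All.all? (λ t → ¬? (covers? X k g t)) S) (All.all? (λ t → ¬? (keeps? X g t)) (over S))
        (uncovered⇔broken X g S))
      (sym (unit (λ t → ¬? (keeps? X g t)) (over S))))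

    uncovered : ∀ S → ∑ (maps (order F) G) (λ g → 1 * ∏ S (λ t → ⟦ ¬? (covers? G k g t) ⟧)) ≡
                      ∑ (maps (order F) H) (λ g → 1 * ∏ S (λ t → ⟦ ¬? (covers? H k g t) ⟧))
    uncovered S = begin
      _ ≡⟨ ∑-uncovered G S ⟩
      _ ≡⟨ inclusion-exclusion (maps (order F))
             -- The roles are reversed: the known sums have kept edges, and broken ones are wanted.
             (λ t {X} g → ⟦ ¬? (keeps? X g t) ⟧) (λ t {X} g → ⟦ keeps? X g t ⟧)
             (λ t {X} g → trans (+-comm ⟦ ¬? (keeps? X g t) ⟧ _) (⟦⟧-¬ (keeps? X g t))) (λ _ → 1) {G} {H}
             (λ S → trans (keeps-edgeMaps G S) (trans
               (edgeMaps-≡ (filter (uncurry (E? F)) S) (All.tabulate (proj₂ ∘ ∈-filter⁻ (uncurry (E? F)) {xs = S})))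
               (sym (keeps-edgeMaps H S))))
             (over S) ⟩
      _ ≡⟨ ∑-uncovered H S ⟨
      _ ∎

  -- Among the pairs with surjective `k` that cover all edges of `F′`, the total is fixed by
  -- `coverMaps-≡` and the proper part by `properSurjections-≡`. The improper rest is a positive
  -- multiple of the count for `F′`.
  contraction-hom-≡ : ∀ {F′} → Contracts F F′ → hom F′ G ≡ hom F′ H
  contraction-hom-≡ {F′} c = begin
    hom F′ G               ≡⟨ hom-edgeMaps F′ G ⟩
    edgeMaps (edges F′) G  ≡⟨ *-cancelˡ-≡ (edgeMaps (edges F′) G) (edgeMaps (edges F′) H) contractions
                                (+-cancelˡ-≡ (properSurjections (edges F′) G) _ _ eq) ⟩
    edgeMaps (edges F′) H  ≡⟨ hom-edgeMaps F′ H ⟨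
    hom F′ H               ∎
    where
    open ≡-Reasoning
    open Factoring F (order F′)
    open Contracts c using (u; v; edge; proj; surjective; identifies) renaming (edges to quotient-edges)

    Degenerate : Vec (V F′) (order F) → Set
    Degenerate k = ∃[ x ] ∃[ y ] (E F x y × lookup k x ≡ lookup k y)

    degenerate? : ∀ k → Dec (Degenerate k)
    degenerate? k = any? λ x → any? λ y → E? F x y ×-dec (lookup k x ≟ lookup k y)

    -- As `k` has a single nontrivial fibre, of size two, a `g` that agrees on the ends of one
    -- collapsed edge is constant on all fibres.
    improper⇔ : ∀ X k g → Surjective k → (¬ Proper X k g) ⇔ (Degenerate k × Respects (lookup k) g)
    improper⇔ X k g surj = mk⇔
      (λ improper → let (x , y , e , kx≡ky , gx≡gy) = witness improper in
        (x , y , e , kx≡ky) ,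
        collapse (contraction-order F-simple c) surj (λ x≡y → F-simple y (subst (λ z → E F z y) x≡y e)) kx≡ky
          (lookup g) gx≡gy)
      (λ ((x , y , e , kx≡ky) , resp) proper → proper x y e (kx≡ky , resp x y kx≡ky))
      where
      Improper : Set
      Improper = ∃[ x ] ∃[ y ] (E F x y × lookup k x ≡ lookup k y × lookup g x ≡ lookup g y)
      improper? : Dec Improper
      improper? = any? λ x → any? λ y → E? F x y ×-dec (lookup k x ≟ lookup k y) ×-dec (lookup g x ≟ lookup g y)
      witness : ¬ Proper X k g → Improper
      witness improper = decidable-stable improper? λ none → improper λ x y e p → none (x , y , e , p)

    surjections : Graph → ℕ
    surjections X = ∑ colourings λ k → ⟦ surjective? k ⟧ *
      ∑ (maps (order F) X) (λ g → ⟦ All.all? (covers? X k g) (edges F′) ⟧)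

    weight : Vec (V F′) (order F) → ℕ
    weight k = ⟦ degenerate? k ⟧ * ⟦ All.all? (coverable? k) (edges F′) ⟧

    contractions : ℕ
    contractions = ∑ colourings λ k → ⟦ surjective? k ⟧ * weight k

    decompose : ∀ X → surjections X ≡ properSurjections (edges F′) X + contractions * edgeMaps (edges F′) X
    decompose X = trans
      (∑-cong colourings λ k → ⟦⟧-*-cong (surjective? k) (trans
        (∑-split gs (λ g → ⟦ proper? X k g ⟧) (λ g → ⟦ ¬? (proper? X k g) ⟧) (all k) (λ g → ⟦⟧-¬ (proper? X k g)))
        ∘ cong (propers k +_) ∘ impropers k))
      (∑-weighted colourings (λ k → ⟦ surjective? k ⟧) propers weight (edgeMaps (edges F′) X))
      where
      gs = maps (order F) X
      all : Vec (V F′) (order F) → Vec (V X) (order F) → ℕ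
      all k g = ⟦ All.all? (covers? X k g) (edges F′) ⟧
      propers : Vec (V F′) (order F) → ℕ
      propers k = ∑ gs λ g → ⟦ proper? X k g ⟧ * all k g
      impropers : ∀ k → Surjective k →
        ∑ gs (λ g → ⟦ ¬? (proper? X k g) ⟧ * all k g) ≡ weight k * edgeMaps (edges F′) X
      impropers k surj = begin
        ∑ gs (λ g → ⟦ ¬? (proper? X k g) ⟧ * all k g)
          ≡⟨ ∑-cong gs (λ g → cong (_* all k g) (trans
               (⟦⟧-cong (¬? (proper? X k g)) (degenerate? k ×-dec respects? (lookup k) g) (improper⇔ X k g surj))
               (⟦⟧-× (degenerate? k) (respects? (lookup k) g)))) ⟩
        ∑ gs (λ g → ⟦ degenerate? k ⟧ * ⟦ respects? (lookup k) g ⟧ * all k g)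
          ≡⟨ ∑-cong gs (λ g → *-assoc ⟦ degenerate? k ⟧ ⟦ respects? (lookup k) g ⟧ (all k g)) ⟩
        ∑ gs (λ g → ⟦ degenerate? k ⟧ * (⟦ respects? (lookup k) g ⟧ * all k g))
          ≡⟨ ∑-*ˡ ⟦ degenerate? k ⟧ gs (λ g → ⟦ respects? (lookup k) g ⟧ * all k g) ⟩
        ⟦ degenerate? k ⟧ * ∑ gs (λ g → ⟦ respects? (lookup k) g ⟧ * all k g)
          ≡⟨ cong (⟦ degenerate? k ⟧ *_) (∑-respects-covers X (edges F′) k surj) ⟩
        ⟦ degenerate? k ⟧ * (⟦ All.all? (coverable? k) (edges F′) ⟧ * edgeMaps (edges F′) X)
          ≡⟨ *-assoc ⟦ degenerate? k ⟧ ⟦ All.all? (coverable? k) (edges F′) ⟧ (edgeMaps (edges F′) X) ⟨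
        weight k * edgeMaps (edges F′) X ∎

    eq : properSurjections (edges F′) G + contractions * edgeMaps (edges F′) G ≡
         properSurjections (edges F′) G + contractions * edgeMaps (edges F′) H
    eq = begin
      _  ≡⟨ decompose G ⟨
      surjections G  ≡⟨ ∑-cong colourings (λ k → cong (⟦ surjective? k ⟧ *_) (coverMaps-≡ k (edges F′))) ⟩
      surjections H  ≡⟨ decompose H ⟩
      _  ≡⟨ cong (_+ contractions * edgeMaps (edges F′) H) (properSurjections-≡ {G} {H} hyp (edges F′)) ⟨
      _  ∎

    instance
      contractions-nonZero : NonZero contractions
      -- The witness is `proj` itself: it collapses the contracted edge, and each edge of `F′` lifts
      -- to an edge of `F`.
      contractions-nonZero = ∑-vecs-nonZero (tabulate proj)
        {λ k → ⟦ surjective? k ⟧ * weight k}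
        (cong₂ _*_
          (⟦⟧-yes (surjective? (tabulate proj)) λ a →
            let (x , eq) = surjective a in x , trans (lookup∘tabulate proj x) eq)
          (cong₂ _*_
            (⟦⟧-yes (degenerate? (tabulate proj)) (u , v , edge , trans (lookup∘tabulate proj u)
              (trans (from (identifies u v) (inj₂ (inj₁ (refl , refl)))) (sym (lookup∘tabulate proj v)))))
            (⟦⟧-yes (All.all? (coverable? (tabulate proj)) (edges F′)) (All.tabulate λ { {a , b} ab∈ →
              let (_ , x , y , px , py , e) = to (quotient-edges a b) (to (∈-edges F′) ab∈) in
              x , y , trans (lookup∘tabulate proj x) px , trans (lookup∘tabulate proj y) py , e }))))

-- The minor-closed class obtained from the logic.

module _ {a b f : Level} (𝓛 : Logic a b) (self-complementary : SelfComplementary 𝓛) where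
  open Logic 𝓛

  -- Self-complementarity is applied to the complement, so `φ̄` is evaluated in the double
  -- complement and carried back to the graph by invariance.
  complement-equivalent : ∀ {G H} → Simple G → Simple H →
    Equivalent 𝓛 G H → Equivalent 𝓛 (complement G) (complement H)
  complement-equivalent {G} {H} G-simple H-simple G≡H φ =
    let (φ̄ , φ⇔φ̄) = self-complementary φ
        via : ∀ X → Simple X → complement X ⊨ φ ⇔ X ⊨ φ̄
        via X simple = ⇔-trans (φ⇔φ̄ (complement X) (complement-simple X))
          (⇔-sym (invariant {X} {complement (complement X)} (complement-involutive {X} simple) φ̄))
    in ⇔-trans (via G G-simple) (⇔-trans (G≡H φ̄) (⇔-sym (via H H-simple)))

  module _ (𝓕 : GraphClass f)
    (characterises : ∀ G H → Simple G → Simple H → HomIndistinguishable 𝓕 G H ⇔ Equivalent 𝓛 G H) where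

    closure : GraphClass f
    closure F = Simple F × (∀ G H → Simple G → Simple H → HomIndistinguishable 𝓕 G H → hom F G ≡ hom F H)

    -- Indistinguishability passes to the products by multiplicativity, then through equivalence in
    -- the logic to their complements and back.
    closure-complement-⊗ : ∀ {F} → F ∈ closure → ∀ {G H} → Simple G → Simple H → HomIndistinguishable 𝓕 G H →
      ∀ K → hom F (complement (G ⊗ K)) ≡ hom F (complement (H ⊗ K))
    closure-complement-⊗ {F} (_ , determined) {G} {H} G-simple H-simple G≡H K =
      determined (complement (G ⊗ K)) (complement (H ⊗ K)) (complement-simple (G ⊗ K)) (complement-simple (H ⊗ K))
        (from (characterises (complement (G ⊗ K)) (complement (H ⊗ K))
                (complement-simple (G ⊗ K)) (complement-simple (H ⊗ K)))
          (complement-equivalent {G ⊗ K} {H ⊗ K} GK-simple HK-simple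
            (to (characterises (G ⊗ K) (H ⊗ K) GK-simple HK-simple) ⊗-indistinguishable)))
      where
      GK-simple : Simple (G ⊗ K)
      GK-simple = ⊗-simple {G} G-simple K
      HK-simple : Simple (H ⊗ K)
      HK-simple = ⊗-simple {H} H-simple K
      ⊗-indistinguishable : HomIndistinguishable 𝓕 (G ⊗ K) (H ⊗ K)
      ⊗-indistinguishable F F∈𝓕 = begin
        hom F (G ⊗ K)      ≡⟨ hom-⊗ F G K ⟩
        hom F G * hom F K  ≡⟨ cong (_* hom F K) (G≡H F F∈𝓕) ⟩
        hom F H * hom F K  ≡⟨ hom-⊗ F H K ⟨
        hom F (H ⊗ K)      ∎
        where open ≡-Reasoning

    closure-contraction : ∀ {F F′} → F ∈ closure → Contracts F F′ → F′ ∈ closure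
    closure-contraction {F} F∈ c =
      (λ p e → proj₁ (to (Contracts.edges c p p) e) refl) ,
      λ G H G-simple H-simple G≡H →
        contraction-hom-≡ F G H (proj₁ F∈) (closure-complement-⊗ {F} F∈ {G} {H} G-simple H-simple G≡H) c

    closure-subgraph : ∀ {F M} → F ∈ closure → Subgraph M F → M ∈ closure
    closure-subgraph {F} {M} F∈ sub@(h , _ , h-hom) =
      (λ u e → proj₁ F∈ (h u) (h-hom u u e)) ,
      λ G H G-simple H-simple G≡H →
        subgraph-hom-≡ F G H (proj₁ F∈) (closure-complement-⊗ {F} F∈ {G} {H} G-simple H-simple G≡H) {M} sub

    closure-minorClosed : MinorClosed closure
    closure-minorClosed {M} {F} F∈ (K , F⇝K , M⊆K) = closure-subgraph {K} {M} (contract {F} {K} F∈ F⇝K) M⊆K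
      where
      contract : ∀ {F K} → F ∈ closure → Star Contracts F K → K ∈ closure
      contract F∈ ε        = F∈
      contract {F} F∈ (_◅_ {j = F′} c cs) = contract (closure-contraction {F} {F′} F∈ c) cs

theorem1 : ∀ {a b f : Level} (𝓛 : Logic a b) → SelfComplementary 𝓛 →
    (Σ[ 𝓕 ∈ GraphClass f ] (𝓕 ⊆ Simple ×
    (∀ G H → Simple G → Simple H → HomIndistinguishable 𝓕 G H ⇔ Equivalent 𝓛 G H))) →
    Σ[ 𝓕′ ∈ GraphClass f ] (𝓕′ ⊆ Simple × MinorClosed 𝓕′ ×
    (∀ G H → Simple G → Simple H → HomIndistinguishable 𝓕′ G H ⇔ Equivalent 𝓛 G H))
theorem1 𝓛 self-complementary (𝓕 , 𝓕⊆Simple , characterises) =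
  closure 𝓛 self-complementary 𝓕 characterises , proj₁ ,
  (λ {M} {F} → closure-minorClosed 𝓛 self-complementary 𝓕 characterises {M} {F}) ,
  λ G H G-simple H-simple → mk⇔
    -- The closure contains `𝓕`, so indistinguishability over it implies that over `𝓕`.
    (λ G≡H → to (characterises G H G-simple H-simple) λ F F∈𝓕 →
      G≡H F (𝓕⊆Simple F∈𝓕 , λ G′ H′ _ _ G′≡H′ → G′≡H′ F F∈𝓕))
    (λ G≡H F F∈ → proj₂ F∈ G H G-simple H-simple (from (characterises G H G-simple H-simple) G≡H))
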